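{- There exists a function $g:\mathbb{N}\to\mathbb{R}$ with $g(k)/k\to 0$ as $k\to\infty$ such that for all integers $k\geq 2$, \[ r(k) \leq 2^{\left(2-\frac{3}{200}\right)k + g(k)}. \]
   Context: For an integer $k\ge 2$, the Ramsey number $r(k)$ is the least integer $N$ such that every two-coloring of the edges of the complete graph $K_N$ contains a monochromatic $K_k$ (a copy of $K_k$ all of whose edges have the same color). -}

module Defs where

open import Data.Bool using (Bool)
open import Data.Nat as ℕ using (ℕ; suc; _≤_; _^_)
open import Data.Integer as ℤ using (ℤ; +_; -[1+_])
open import Data.Fin using (Fin)
open import Data.Product using (_,_; Σ; ∃; _×_; Σ-syntax; ∃-syntax)
open import Data.Rational using (ℚ; ↥_; ↧ₙ_)
open import Function.Definitions using (Injective)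
open import Relation.Binary.PropositionalEquality using (_≡_; _≢_)

-- A two-colouring of the edges of K_N: a symmetric map on pairs of vertices
-- (the value on the diagonal is irrelevant).
Colouring : ℕ → Set
Colouring N = Σ[ c ∈ (Fin N → Fin N → Bool) ] (∀ u v → c u v ≡ c v u)

HasMonoClique : ∀ {N} → Colouring N → ℕ → Set
HasMonoClique {N} (c , _) k =
  Σ[ f ∈ (Fin k → Fin N) ] (Injective _≡_ _≡_ f ×
    ∃[ b ] (∀ i j → i ≢ j → c (f i) (f j) ≡ b))


RamseyProperty : ℕ → ℕ → Set
RamseyProperty k N = (col : Colouring N) → HasMonoClique col k

IsRamseyNumber : ℕ → ℕ → Set
IsRamseyNumber k N = RamseyProperty k N × (∀ M → RamseyProperty k M → N ≤ M)

-- N ≤ 2^x for a rational x = p/q (q > 0):  N^q ≤ 2^p, i.e.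
-- N^q * 2^(max(-p,0)) ≤ 2^(max(p,0)).
_≤2^_ : ℕ → ℚ → Set
N ≤2^ x with ↥ x
... | + p      = N ^ (↧ₙ x) ≤ 2 ^ p
... | -[1+ p ] = N ^ (↧ₙ x) ℕ.* 2 ^ (suc p) ≤ 1

{-# OPTIONS --safe #-}

-- Idea.  A pair (x, y) is a linear bound if r(k, ℓ) ≤ C x^(-k) y^(-ℓ) for all k and ℓ; Erdős–Szekeres gives
-- every pair with x + y = 1.  A known linear bound is improved as follows (Campos–Griffiths–Morris–Sahasrabudhe,
-- in the inductive form of Gupta–Ndiaye–Norin–Wei).  If the red density of a vertex set is at most 1 - y, some
-- vertex has a large blue neighbourhood and ℓ drops.  Otherwise let X = Y be the whole set and follow pairs
-- (X, Y), with p slightly below the density and e the excess of the red density of (X, Y) over p, through the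
-- potential |X| |Y| e^M for a large constant M.  By convexity some v ∈ X has the property that the pairs
-- (N_R(v) ∩ X, N_R(v) ∩ Y) and (N_B(v) ∩ X, N_R(v) ∩ Y) have on average no less excess than (X, Y), so one of them
-- loses only a controlled factor of potential.  If v has blue degree above β |X|, the second pair could lose too
-- much, but if there are many such v, then they contain a large blue clique, hence a blue book with pages in X,
-- and the step to these pages does not shrink Y.  When X is exhausted, Y is still large enough for
-- Erdős–Szekeres.  Four such improvements, at ratios ℓ/k = 0.3, 0.55, 0.7, 0.85, lead from (0.77, 0.23) to
-- (0.559, 0.453), and 0.559 · 0.453 > 2^(-397/200).
-- All real parameters are rationals given by numerators over t, or over E for the tangent slopes, and every
-- inequality is multiplied out in ℕ.

module Submission where

open import Defs

module RamseyBounds where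

  open import Data.Nat using (ℕ; zero; suc; _+_; _*_; _∸_; _^_; _≤_; _<_; _≤ᵇ_; _/_; z≤n; s≤s; NonZero; >-nonZero)
  open import Data.Nat.Properties
  open import Data.Nat.DivMod using (m≡m%n+[m/n]*n; m%n<n; m/n*n≤m)
  open import Data.Nat.Tactic.RingSolver using (solve-∀)
  open import Data.Bool using (Bool; true; false; not; _∧_) renaming (T to IsTrue)
  open import Data.Bool.Properties using (∧-comm; ∧-idem) renaming (_≟_ to _≟ᵇ_)
  open import Data.Empty using (⊥; ⊥-elim)
  open import Data.Fin using (Fin; zero; suc; finToFun; funToFin)
  open import Data.Fin.Properties using (all?; any?; finToFun-funToFin) renaming (_≟_ to _≟ᶠ_)
  open import Data.List using (List; []; _∷_; length; filterᵇ; take; lookup; allFin)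
  open import Data.List.Properties using (length-take; length-tabulate)
  open import Data.List.Membership.Propositional using (_∈_)
  open import Data.List.Membership.Propositional.Properties using (∈-lookup)
  open import Data.List.Relation.Unary.All as All using (All; []; _∷_)
  open import Data.List.Relation.Unary.AllPairs as AllPairs using (AllPairs; []; _∷_)
  import Data.List.Relation.Unary.AllPairs.Properties as AllPairsₚ
  open import Data.List.Relation.Unary.Any using (here; there)
  open import Data.List.Relation.Unary.Unique.Propositional using (Unique)
  open import Data.List.Relation.Unary.Unique.Propositional.Properties using (allFin⁺)
  open import Data.Product using (Σ; ∃; _×_; _,_; proj₁; proj₂)
  open import Data.Sum using (_⊎_; inj₁; inj₂)
  open import Data.Unit using (tt)
  open import Function using (_∘_)
  open import Function.Definitions using (Injective)
  open import Relation.Binary.PropositionalEquality using (_≡_; _≢_; refl; sym; trans; cong; cong₂; subst; subst₂)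
  open import Relation.Nullary using (¬_; yes; no; Dec; ¬?; _×-dec_; _→-dec_; _⊎-dec_)
  open import Relation.Nullary.Decidable using (map′; does)

  -- Inequalities between powers

  *-cancel-≤ : ∀ m {a b} → 0 < m → m * a ≤ m * b → a ≤ b
  *-cancel-≤ m m>0 = *-cancelˡ-≤ m {{>-nonZero m>0}}

  ^-pos : ∀ {m} n → 0 < m → 0 < m ^ n
  ^-pos {m} n m>0 = m^n>0 m {{>-nonZero m>0}} n

  ^-distrib-* : ∀ m n k → (m * n) ^ k ≡ m ^ k * n ^ k
  ^-distrib-* m n zero    = refl
  ^-distrib-* m n (suc k) rewrite ^-distrib-* m n k = shuffle m n (m ^ k) (n ^ k)
    where
    shuffle : ∀ m n p q → m * n * (p * q) ≡ m * p * (n * q)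
    shuffle = solve-∀

  ^-comm : ∀ m j k → (m ^ j) ^ k ≡ (m ^ k) ^ j
  ^-comm m j k = trans (^-*-assoc m j k) (trans (cong (m ^_) (*-comm j k)) (sym (^-*-assoc m k j)))

  ^-mono-≤ : ∀ k {a b} → a ≤ b → a ^ k ≤ b ^ k
  ^-mono-≤ k = ^-monoˡ-≤ k

  ^-mono-< : ∀ n {a b} → a < b → a ^ suc n < b ^ suc n
  ^-mono-< zero    {a} {b} a<b = subst₂ _<_ (sym (*-identityʳ a)) (sym (*-identityʳ b)) a<b
  ^-mono-< (suc n) {a} {b} a<b = *-mono-< a<b (^-mono-< n a<b)

  -- Replaces taking roots: comparisons of real powers are made after raising both sides to a common
  -- positive exponent.
  ^-cancel-≤ : ∀ n {a b} → a ^ suc n ≤ b ^ suc n → a ≤ b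
  ^-cancel-≤ n {a} {b} h with a ≤? b
  ... | yes a≤b = a≤b
  ... | no  a≰b = ⊥-elim (<⇒≱ (^-mono-< n (≰⇒> a≰b)) h)

  two-squares : ∀ a b → 2 * (a * b) ≤ a * a + b * b
  two-squares a b with ≤-total a b
  ... | inj₁ a≤b with m≤n⇒∃[o]m+o≡n a≤b
  ...   | d , refl = subst (2 * (a * (a + d)) ≤_) (expand a d) (m≤m+n _ (d * d))
    where
    expand : ∀ a d → 2 * (a * (a + d)) + d * d ≡ a * a + (a + d) * (a + d)
    expand = solve-∀
  two-squares a b | inj₂ b≤a with m≤n⇒∃[o]m+o≡n b≤a
  ...   | d , refl = subst (2 * ((b + d) * b) ≤_) (expand b d) (m≤m+n _ (d * d))
    where
    expand : ∀ b d → 2 * ((b + d) * b) + d * d ≡ (b + d) * (b + d) + b * b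
    expand = solve-∀

  -- The convex function s ^ (n + 1) lies above its tangent at b; the negative terms are moved
  -- across so that the inequality makes sense in ℕ.
  bernoulli : ∀ n s b → suc n * b ^ n * s ≤ s ^ suc n + n * b ^ suc n
  bernoulli zero    s b = ≤-reflexive (base s)
    where
    base : ∀ s → 1 * 1 * s ≡ s * 1 + 0
    base = solve-∀
  -- The added term completes the left side to (n + 1) b^n (2 s b), to which `two-squares` applies.
  bernoulli (suc n) s b = +-cancelʳ-≤ (n * (b * q) * s) _ _ (begin
    suc (suc n) * (b * q) * s + n * (b * q) * s   ≡⟨ e₁ n b q s ⟩
    suc n * q * (2 * (s * b))                      ≤⟨ *-monoʳ-≤ (suc n * q) (two-squares s b) ⟩
    suc n * q * (s * s + b * b)                    ≡⟨ e₂ n b q s ⟩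
    (suc n * q * s) * s + suc n * (b * (b * q))    ≤⟨ +-monoˡ-≤ _ (*-monoˡ-≤ s (bernoulli n s b)) ⟩
    (s * p + n * (b * q)) * s + suc n * (b * (b * q)) ≡⟨ e₃ n b q s p ⟩
    s * (s * p) + suc n * (b * (b * q)) + n * (b * q) * s ∎)
    where
    open ≤-Reasoning
    p = s ^ n
    q = b ^ n
    e₁ : ∀ n b q s → suc (suc n) * (b * q) * s + n * (b * q) * s ≡ suc n * q * (2 * (s * b))
    e₁ = solve-∀
    e₂ : ∀ n b q s → suc n * q * (s * s + b * b) ≡ (suc n * q * s) * s + suc n * (b * (b * q))
    e₂ = solve-∀
    e₃ : ∀ n b q s p → (s * p + n * (b * q)) * s + suc n * (b * (b * q)) ≡ s * (s * p) + suc n * (b * (b * q)) + n * (b * q) * s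
    e₃ = solve-∀

  -- Bernoulli at (n + 1) b, applied to the sum of the n + 1 numbers a, b, …, b.
  amgm : ∀ n a b → a * b ^ n * suc n ^ suc n ≤ (n * b + a) ^ suc n
  amgm n a b = +-cancelʳ-≤ (n * (suc n * b) ^ suc n) _ _ (begin
    a * b ^ n * suc n ^ suc n + n * (suc n * b) ^ suc n
      ≡⟨ cong (λ z → a * b ^ n * suc n ^ suc n + n * z) (^-distrib-* (suc n) b (suc n)) ⟩
    a * b ^ n * (suc n * suc n ^ n) + n * (suc n * suc n ^ n * (b * b ^ n))
      ≡⟨ e n a b (b ^ n) (suc n ^ n) ⟩
    suc n * (suc n ^ n * b ^ n) * (n * b + a)
      ≡⟨ cong (λ z → suc n * z * (n * b + a)) (sym (^-distrib-* (suc n) b n)) ⟩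
    suc n * (suc n * b) ^ n * (n * b + a)
      ≤⟨ bernoulli n (n * b + a) (suc n * b) ⟩
    (n * b + a) ^ suc n + n * (suc n * b) ^ suc n ∎)
    where
    open ≤-Reasoning
    e : ∀ n a b q r → a * q * (suc n * r) + n * (suc n * r * (b * q)) ≡ suc n * (r * q) * (n * b + a)
    e = solve-∀

  -- Sums over lists

  private variable
    Elem Elem′ : Set

  ∑ : List Elem → (Elem → ℕ) → ℕ
  ∑ []       f = 0
  ∑ (x ∷ xs) f = f x + ∑ xs f

  ∑-mono : (xs : List Elem) {f g : Elem → ℕ} → (∀ {x} → x ∈ xs → f x ≤ g x) → ∑ xs f ≤ ∑ xs g
  ∑-mono []       h = z≤n
  ∑-mono (x ∷ xs) h = +-mono-≤ (h (here refl)) (∑-mono xs (λ x∈ → h (there x∈)))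

  ∑-cong : (xs : List Elem) {f g : Elem → ℕ} → (∀ x → f x ≡ g x) → ∑ xs f ≡ ∑ xs g
  ∑-cong []       h = refl
  ∑-cong (x ∷ xs) h = cong₂ _+_ (h x) (∑-cong xs h)

  ∑-+ : (xs : List Elem) (f g : Elem → ℕ) → ∑ xs (λ x → f x + g x) ≡ ∑ xs f + ∑ xs g
  ∑-+ []       f g = refl
  ∑-+ (x ∷ xs) f g rewrite ∑-+ xs f g = shuffle (f x) (g x) (∑ xs f) (∑ xs g)
    where
    shuffle : ∀ a b c d → a + b + (c + d) ≡ a + c + (b + d)
    shuffle = solve-∀

  ∑-* : (xs : List Elem) (k : ℕ) (f : Elem → ℕ) → ∑ xs (λ x → k * f x) ≡ k * ∑ xs f
  ∑-* []       k f = sym (*-zeroʳ k)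
  ∑-* (x ∷ xs) k f rewrite ∑-* xs k f = sym (*-distribˡ-+ k (f x) (∑ xs f))

  ∑-const : (xs : List Elem) (k : ℕ) → ∑ xs (λ _ → k) ≡ length xs * k
  ∑-const []       k = refl
  ∑-const (x ∷ xs) k = cong (k +_) (∑-const xs k)

  ∑-swap : (xs : List Elem) (ys : List Elem′) (f : Elem → Elem′ → ℕ) →
    ∑ xs (λ x → ∑ ys (f x)) ≡ ∑ ys (λ y → ∑ xs (λ x → f x y))
  ∑-swap []       ys f = sym (trans (∑-const ys 0) (*-zeroʳ (length ys)))
  ∑-swap (x ∷ xs) ys f rewrite ∑-swap xs ys f = sym (∑-+ ys (f x) _)

  find-≤ : (xs : List Elem) (f g : Elem → ℕ) → 0 < length xs → ∑ xs f ≤ ∑ xs g → ∃ λ x → x ∈ xs × f x ≤ g x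
  find-≤ (x ∷ xs) f g _ h with f x ≤? g x
  ... | yes p = x , here refl , p
  find-≤ (x ∷ [])     f g _ h | no p = ⊥-elim (p (subst₂ _≤_ (+-identityʳ _) (+-identityʳ _) h))
  find-≤ (x ∷ y ∷ xs) f g _ h | no p
    with find-≤ (y ∷ xs) f g (s≤s z≤n)
           (<⇒≤ (+-cancelˡ-< (g x) _ _ (<-≤-trans (+-monoˡ-< _ (≰⇒> p)) h)))
  ... | z , z∈ , q = z , there z∈ , q

  search-< : (xs : List Elem) (f g : Elem → ℕ) →
    (∃ λ x → x ∈ xs × f x < g x) ⊎ (∀ {x} → x ∈ xs → g x ≤ f x)
  search-< [] f g = inj₂ λ ()
  search-< (x ∷ xs) f g with f x <? g x | search-< xs f g
  ... | yes p | _                  = inj₁ (x , here refl , p)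
  ... | no p  | inj₁ (y , y∈ , q)  = inj₁ (y , there y∈ , q)
  ... | no p  | inj₂ h             = inj₂ λ { (here refl) → ≮⇒≥ p ; (there z∈) → h z∈ }

  -- The effect on every sum is returned with the shorter list, because degrees and edge counts are
  -- such sums.
  remove : {x : Elem} (xs : List Elem) → x ∈ xs → Unique xs →
    ∃ λ xs′ → Unique xs′ × (∀ {z} → z ∈ xs′ → z ∈ xs × x ≢ z) × length xs ≡ suc (length xs′) ×
              (∀ f → ∑ xs f ≡ f x + ∑ xs′ f)
  remove (x ∷ xs) (here refl) (x∉ ∷ u) = xs , u , (λ z∈ → there z∈ , All.lookup x∉ z∈) , refl , λ f → refl
  remove {x = x} (y ∷ xs) (there x∈) (y∉ ∷ u) with remove xs x∈ u
  ... | xs′ , u′ , sub , len , sums =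
    y ∷ xs′ , All.tabulate (λ z∈ → All.lookup y∉ (proj₁ (sub z∈))) ∷ u′ , sub′ , cong suc len
    , λ f → trans (cong (f y +_) (sums f)) (shuffle (f y) (f x) (∑ xs′ f))
    where
    sub′ : ∀ {z} → z ∈ y ∷ xs′ → z ∈ y ∷ xs × x ≢ z
    sub′ (here refl) = here refl , λ { refl → All.lookup y∉ x∈ refl }
    sub′ (there p)   = there (proj₁ (sub p)) , proj₂ (sub p)
    shuffle : ∀ a b c → a + (b + c) ≡ b + (a + c)
    shuffle = solve-∀

  ⟦_⟧ : Bool → ℕ
  ⟦ true ⟧  = 1
  ⟦ false ⟧ = 0

  ∑-filter : (p : Elem → Bool) (xs : List Elem) (f : Elem → ℕ) → ∑ (filterᵇ p xs) f ≡ ∑ xs (λ x → ⟦ p x ⟧ * f x)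
  ∑-filter p []       f = refl
  ∑-filter p (x ∷ xs) f with p x
  ... | true  = cong₂ _+_ (sym (+-identityʳ (f x))) (∑-filter p xs f)
  ... | false = ∑-filter p xs f

  length-filter : (p : Elem → Bool) (xs : List Elem) → length (filterᵇ p xs) ≡ ∑ xs (λ x → ⟦ p x ⟧)
  length-filter p []       = refl
  length-filter p (x ∷ xs) with p x
  ... | true  = cong suc (length-filter p xs)
  ... | false = length-filter p xs

  ∈-filterᵇ : (p : Elem → Bool) {x : Elem} (xs : List Elem) → x ∈ filterᵇ p xs → x ∈ xs × p x ≡ true
  ∈-filterᵇ p (y ∷ xs) h with p y in eq
  ∈-filterᵇ p (y ∷ xs) (here refl) | true = here refl , eq
  ∈-filterᵇ p (y ∷ xs) (there h)   | true with ∈-filterᵇ p xs h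
  ... | a , b = there a , b
  ∈-filterᵇ p (y ∷ xs) h | false with ∈-filterᵇ p xs h
  ... | a , b = there a , b

  Unique-filterᵇ : (p : Elem → Bool) (xs : List Elem) → Unique xs → Unique (filterᵇ p xs)
  Unique-filterᵇ p [] u = []
  Unique-filterᵇ p (x ∷ xs) (x∉ ∷ u) with p x
  ... | true  = All.tabulate (λ z∈ → All.lookup x∉ (proj₁ (∈-filterᵇ p xs z∈))) ∷ Unique-filterᵇ p xs u
  ... | false = Unique-filterᵇ p xs u

  length-filter-≤ : (p : Elem → Bool) (xs : List Elem) → length (filterᵇ p xs) ≤ length xs
  length-filter-≤ p []       = z≤n
  length-filter-≤ p (x ∷ xs) with p x
  ... | true  = s≤s (length-filter-≤ p xs)
  ... | false = m≤n⇒m≤1+n (length-filter-≤ p xs)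

  length-filter-< : (p : Elem → Bool) {x : Elem} (xs : List Elem) → x ∈ xs → p x ≡ false → length (filterᵇ p xs) < length xs
  length-filter-< p (x ∷ xs) (here refl) eq rewrite eq = s≤s (length-filter-≤ p xs)
  length-filter-< p (y ∷ xs) (there x∈) eq with p y
  ... | true  = s≤s (length-filter-< p xs x∈ eq)
  ... | false = m≤n⇒m≤1+n (length-filter-< p xs x∈ eq)

  -- Expand the square into a double sum and apply `two-squares` to each pair of terms.
  cauchy-schwarz : (xs : List Elem) (f : Elem → ℕ) → ∑ xs f * ∑ xs f ≤ length xs * ∑ xs (λ x → f x * f x)
  cauchy-schwarz xs f = *-cancel-≤ 2 (s≤s z≤n) (begin
    2 * (∑ xs f * ∑ xs f)                                        ≡⟨ cong (2 *_) square ⟩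
    2 * ∑ xs (λ x → ∑ xs (λ y → f x * f y))                      ≡⟨ sym (∑-* xs 2 _) ⟩
    ∑ xs (λ x → 2 * ∑ xs (λ y → f x * f y))                      ≡⟨ ∑-cong xs (λ x → sym (∑-* xs 2 _)) ⟩
    ∑ xs (λ x → ∑ xs (λ y → 2 * (f x * f y)))
      ≤⟨ ∑-mono xs (λ {x} _ → ∑-mono xs (λ {y} _ → two-squares (f x) (f y))) ⟩
    ∑ xs (λ x → ∑ xs (λ y → f x * f x + f y * f y))
      ≡⟨ ∑-cong xs (λ x → trans (∑-+ xs _ _) (cong (_+ Q) (∑-const xs (f x * f x)))) ⟩
    ∑ xs (λ x → length xs * (f x * f x) + Q)                      ≡⟨ ∑-+ xs _ _ ⟩
    ∑ xs (λ x → length xs * (f x * f x)) + ∑ xs (λ _ → Q)        ≡⟨ cong₂ _+_ (∑-* xs (length xs) _) (∑-const xs Q) ⟩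
    length xs * Q + length xs * Q                                 ≡⟨ double (length xs * Q) ⟩
    2 * (length xs * Q)                                           ∎)
    where
    open ≤-Reasoning
    Q = ∑ xs (λ x → f x * f x)
    square : ∑ xs f * ∑ xs f ≡ ∑ xs (λ x → ∑ xs (λ y → f x * f y))
    square = trans (sym (∑-* xs (∑ xs f) f))
      (∑-cong xs (λ x → trans (*-comm (∑ xs f) (f x)) (sym (∑-* xs (f x) f))))
    double : ∀ a → a + a ≡ 2 * a
    double = solve-∀

  -- Jensen's inequality: the tangent inequality at a is summed over the list, and the hypothesis on
  -- the mean controls its linear term.
  power-mean : ∀ n a (xs : List Elem) (g : Elem → ℕ) → length xs * a ≤ ∑ xs g →
    length xs * a ^ suc n ≤ ∑ xs (λ x → g x ^ suc n)
  power-mean n a xs g h = +-cancelʳ-≤ (length xs * (n * a ^ suc n)) _ _ (begin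
    length xs * a ^ suc n + length xs * (n * a ^ suc n)            ≡⟨ e (length xs) n a (a ^ n) ⟩
    suc n * a ^ n * (length xs * a)                                ≤⟨ *-monoʳ-≤ (suc n * a ^ n) h ⟩
    suc n * a ^ n * ∑ xs g                                         ≡⟨ sym (∑-* xs (suc n * a ^ n) g) ⟩
    ∑ xs (λ x → suc n * a ^ n * g x)                               ≤⟨ ∑-mono xs (λ {x} _ → bernoulli n (g x) a) ⟩
    ∑ xs (λ x → g x ^ suc n + n * a ^ suc n)                       ≡⟨ ∑-+ xs _ _ ⟩
    ∑ xs (λ x → g x ^ suc n) + ∑ xs (λ _ → n * a ^ suc n)          ≡⟨ cong (∑ xs (λ x → g x ^ suc n) +_) (∑-const xs _) ⟩
    ∑ xs (λ x → g x ^ suc n) + length xs * (n * a ^ suc n)         ∎)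
    where
    open ≤-Reasoning
    e : ∀ l n a q → l * (a * q) + l * (n * (a * q)) ≡ suc n * q * (l * a)
    e = solve-∀

  -- Cliques and the Erdős–Szekeres bound

  -- Two irreflexive relations rather than one colouring, so that each neighbourhood is a filter
  -- that leaves out its own vertex.
  record Graph (V : Set) : Set where
    field
      R B      : V → V → Bool
      R-irrefl : ∀ v → R v v ≡ false
      B-irrefl : ∀ v → B v v ≡ false
      B-sym    : ∀ v w → B v w ≡ B w v
      cover    : ∀ v w → v ≡ w ⊎ (R v w ≡ true × B v w ≡ false) ⊎ (R v w ≡ false × B v w ≡ true)

  module _ {V : Set} where

    -- Irreflexivity of the colour makes the listed vertices distinct. The predicate allows cliques
    -- in a union of two sets without forming the union.
    Clique : (V → V → Bool) → ℕ → (V → Set) → Set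
    Clique c n P = ∃ λ vs → length vs ≡ n × AllPairs (λ v w → c v w ≡ true) vs × (∀ {v} → v ∈ vs → P v)

    clique-⊆ : ∀ {c n} {P Q : V → Set} → (∀ {v} → P v → Q v) → Clique c n P → Clique c n Q
    clique-⊆ sub (vs , len , prs , h) = vs , len , prs , λ v∈ → sub (h v∈)

    clique-∅ : ∀ {c} {P : V → Set} → Clique c 0 P
    clique-∅ = [] , refl , [] , λ ()

    clique-∷ : ∀ {c n} {P Q : V → Set} v → P v → (∀ {w} → Q w → P w × c v w ≡ true) →
      Clique c n Q → Clique c (suc n) P
    clique-∷ {P = P} v pv sub (vs , len , prs , h) =
      v ∷ vs , cong suc len , All.tabulate (λ w∈ → proj₂ (sub (h w∈))) ∷ prs
      , λ { (here p) → subst P (sym p) pv ; (there w∈) → proj₁ (sub (h w∈)) }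

    clique-≤ : ∀ {c m n} {P : V → Set} → m ≤ n → Clique c n P → Clique c m P
    clique-≤ {m = m} m≤n (vs , refl , prs , h) =
      take m vs , trans (length-take m vs) (m≤n⇒m⊓n≡m m≤n) , AllPairsₚ.take⁺ m prs , λ v∈ → h (∈-take m vs v∈)
      where
      ∈-take : ∀ {v} m (vs : List V) → v ∈ take m vs → v ∈ vs
      ∈-take (suc m) (x ∷ vs) (here p)  = here p
      ∈-take (suc m) (x ∷ vs) (there p) = there (∈-take m vs p)

    nbr : (V → V → Bool) → V → List V → List V
    nbr c v = filterᵇ (c v)

  -- The linear bound (a/t, b/t): r(k, ℓ) ≤ C (t/a)^k (t/b)^ℓ, multiplied out.
  RamseyBound : ∀ {V} → Graph V → (t a b C : ℕ) → Set
  RamseyBound G t a b C = ∀ k ℓ Y → Unique Y → C * t ^ (k + ℓ) ≤ length Y * (a ^ k * b ^ ℓ) →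
    Clique R k (_∈ Y) ⊎ Clique B ℓ (_∈ Y)
    where open Graph G

  module _ {V : Set} (G : Graph V) where
    open Graph G

    split-∉ : ∀ v (X : List V) → All (v ≢_) X → ∀ f → ∑ X f ≡ ∑ (nbr R v X) f + ∑ (nbr B v X) f
    split-∉ v []      []         f = refl
    split-∉ v (x ∷ X) (v≢x ∷ v∉) f with cover v x
    ... | inj₁ v≡x = ⊥-elim (v≢x v≡x)
    ... | inj₂ (inj₁ (r , b)) rewrite r | b | split-∉ v X v∉ f = sym (+-assoc (f x) _ _)
    ... | inj₂ (inj₂ (r , b)) rewrite r | b | split-∉ v X v∉ f = shuffle (f x) (∑ (nbr R v X) f) _
      where
      shuffle : ∀ a b c → a + (b + c) ≡ b + (a + c)
      shuffle = solve-∀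

    -- Only v itself lies in neither neighbourhood, and by uniqueness it occurs at most once.
    split-≤ : ∀ v (X : List V) → Unique X → ∀ f → ∑ X f ≤ f v + (∑ (nbr R v X) f + ∑ (nbr B v X) f)
    split-≤ v []      u          f = z≤n
    split-≤ v (x ∷ X) (x∉ ∷ u) f with cover v x
    ... | inj₁ refl rewrite R-irrefl v | B-irrefl v = +-monoʳ-≤ (f v) (≤-reflexive (split-∉ v X x∉ f))
    ... | inj₂ (inj₁ (r , b)) rewrite r | b =
      ≤-trans (+-monoʳ-≤ (f x) (split-≤ v X u f)) (≤-reflexive (shuffle (f x) (f v) _ _))
      where
      shuffle : ∀ a b c d → a + (b + (c + d)) ≡ b + (a + c + d)
      shuffle = solve-∀
    ... | inj₂ (inj₂ (r , b)) rewrite r | b =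
      ≤-trans (+-monoʳ-≤ (f x) (split-≤ v X u f)) (≤-reflexive (shuffle (f x) (f v) (∑ (nbr R v X) f) _))
      where
      shuffle : ∀ a b c d → a + (b + (c + d)) ≡ b + (c + (a + d))
      shuffle = solve-∀

    degrees-≤ : ∀ v (X : List V) → length (nbr R v X) + length (nbr B v X) ≤ length X
    degrees-≤ v []      = z≤n
    degrees-≤ v (x ∷ X) with cover v x
    ... | inj₁ refl rewrite R-irrefl v | B-irrefl v = m≤n⇒m≤1+n (degrees-≤ v X)
    ... | inj₂ (inj₁ (r , b)) rewrite r | b = s≤s (degrees-≤ v X)
    ... | inj₂ (inj₂ (r , b)) rewrite r | b = ≤-trans (≤-reflexive (+-suc _ _)) (s≤s (degrees-≤ v X))

    length≡∑ : (X : List V) → length X ≡ ∑ X (λ _ → 1)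
    length≡∑ X = sym (trans (∑-const X 1) (*-identityʳ _))

    -- Assuming |Y| + 1 instead of |Y| compensates for the vertex lost in each step.
    erdős-szekeres⁺ : ∀ a b → 0 < a → 0 < b → ∀ k ℓ Y → Unique Y →
      (a + b) ^ (k + ℓ) ≤ suc (length Y) * (a ^ k * b ^ ℓ) → Clique R k (_∈ Y) ⊎ Clique B ℓ (_∈ Y)
    erdős-szekeres⁺ a b a>0 b>0 zero    ℓ       Y u h = inj₁ clique-∅
    erdős-szekeres⁺ a b a>0 b>0 (suc k) zero    Y u h = inj₂ clique-∅
    erdős-szekeres⁺ a b a>0 b>0 (suc k) (suc ℓ) [] u h = ⊥-elim (<-irrefl refl (begin-strict
      (a * b) * (a ^ k * b ^ ℓ)              <⟨ *-monoˡ-< _ {{>-nonZero (*-mono-≤ (^-pos k a>0) (^-pos ℓ b>0))}} ab<tt ⟩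
      (t * t) * (a ^ k * b ^ ℓ)              ≤⟨ *-monoʳ-≤ (t * t) (*-mono-≤ (^-mono-≤ k (m≤m+n a b)) (^-mono-≤ ℓ (m≤n+m b a))) ⟩
      (t * t) * (t ^ k * t ^ ℓ)              ≡⟨ e₁ t (t ^ k) (t ^ ℓ) ⟩
      t ^ suc k * t ^ suc ℓ                  ≡⟨ sym (^-distribˡ-+-* t (suc k) (suc ℓ)) ⟩
      t ^ (suc k + suc ℓ)                    ≤⟨ h ⟩
      1 * (a ^ suc k * b ^ suc ℓ)            ≡⟨ e₂ a b (a ^ k) (b ^ ℓ) ⟩
      (a * b) * (a ^ k * b ^ ℓ)              ∎))
      where
      open ≤-Reasoning
      t = a + b
      ab<tt : a * b < t * t
      ab<tt = *-mono-< (m<m+n a b>0) (m<n+m b a>0)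
      e₁ : ∀ t p q → (t * t) * (p * q) ≡ t * p * (t * q)
      e₁ = solve-∀
      e₂ : ∀ a b p q → 1 * ((a * p) * (b * q)) ≡ (a * b) * (p * q)
      e₂ = solve-∀
    erdős-szekeres⁺ a b a>0 b>0 (suc k) (suc ℓ) (v ∷ Y) (v∉ ∷ u) h
      with (a + b) ^ (k + suc ℓ) ≤? suc (length (nbr R v Y)) * (a ^ k * b ^ suc ℓ)
         | (a + b) ^ (suc k + ℓ) ≤? suc (length (nbr B v Y)) * (a ^ suc k * b ^ ℓ)
    ... | yes hr | _ with erdős-szekeres⁺ a b a>0 b>0 k (suc ℓ) (nbr R v Y) (Unique-filterᵇ _ Y u) hr
    ...   | inj₁ K = inj₁ (clique-∷ v (here refl) (λ w∈ → let w∈Y , r = ∈-filterᵇ _ Y w∈ in there w∈Y , r) K)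
    ...   | inj₂ K = inj₂ (clique-⊆ (λ w∈ → there (proj₁ (∈-filterᵇ _ Y w∈))) K)
    erdős-szekeres⁺ a b a>0 b>0 (suc k) (suc ℓ) (v ∷ Y) (v∉ ∷ u) h
        | no _ | yes hb with erdős-szekeres⁺ a b a>0 b>0 (suc k) ℓ (nbr B v Y) (Unique-filterᵇ _ Y u) hb
    ...   | inj₁ K = inj₁ (clique-⊆ (λ w∈ → there (proj₁ (∈-filterᵇ _ Y w∈))) K)
    ...   | inj₂ K = inj₂ (clique-∷ v (here refl) (λ w∈ → let w∈Y , r = ∈-filterᵇ _ Y w∈ in there w∈Y , r) K)
    -- The whole list has r + s + 1 vertices, and (r + s + 1) + 1 = (r + 1) + (s + 1). Hence the two
    -- failed bounds, weighted by a and b, add up to a contradiction.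
    erdős-szekeres⁺ a b a>0 b>0 (suc k) (suc ℓ) (v ∷ Y) (v∉ ∷ u) h
        | no hr | no hb = ⊥-elim (<-irrefl refl (begin-strict
      (a + b) ^ (suc k + suc ℓ)     ≤⟨ h ⟩
      suc (suc (length Y)) * (a ^ suc k * b ^ suc ℓ)
        ≡⟨ cong (λ z → suc (suc z) * (a ^ suc k * b ^ suc ℓ)) len ⟩
      suc (suc (r + s)) * (a ^ suc k * b ^ suc ℓ)
        ≡⟨ e₁ a b r s (a ^ k) (b ^ ℓ) ⟩
      a * (suc r * (a ^ k * b ^ suc ℓ)) + b * (suc s * (a ^ suc k * b ^ ℓ))
        <⟨ +-mono-< (*-monoʳ-< a {{>-nonZero a>0}} (≰⇒> hr)) (*-monoʳ-< b {{>-nonZero b>0}} (≰⇒> hb)) ⟩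
      a * (a + b) ^ (k + suc ℓ) + b * (a + b) ^ (suc k + ℓ)
        ≡⟨ cong (λ z → a * (a + b) ^ z + b * (a + b) ^ (suc k + ℓ)) (+-suc k ℓ) ⟩
      a * (a + b) ^ suc (k + ℓ) + b * (a + b) ^ suc (k + ℓ)
        ≡⟨ sym (*-distribʳ-+ _ a b) ⟩
      (a + b) ^ suc (suc (k + ℓ))
        ≡⟨ cong (λ z → (a + b) ^ suc z) (sym (+-suc k ℓ)) ⟩
      (a + b) ^ (suc k + suc ℓ) ∎))
      where
      open ≤-Reasoning
      r = length (nbr R v Y)
      s = length (nbr B v Y)
      len : length Y ≡ r + s
      len = trans (length≡∑ Y) (trans (split-∉ v Y v∉ (λ _ → 1))
              (cong₂ _+_ (sym (length≡∑ (nbr R v Y))) (sym (length≡∑ (nbr B v Y)))))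
      e₁ : ∀ a b r s p q → suc (suc (r + s)) * ((a * p) * (b * q)) ≡
           a * (suc r * (p * (b * q))) + b * (suc s * ((a * p) * q))
      e₁ = solve-∀

    erdős-szekeres : ∀ a b → 0 < a → 0 < b → RamseyBound G (a + b) a b 1
    erdős-szekeres a b a>0 b>0 k ℓ Y u h = erdős-szekeres⁺ a b a>0 b>0 k ℓ Y u
      (≤-trans (≤-trans (≤-reflexive (sym (*-identityˡ _))) h) (*-monoˡ-≤ _ (n≤1+n (length Y))))

  -- Blue books

  module _ {V : Set} (G : Graph V) where
    open Graph G

    private
      degB : List V → V → ℕ
      degB U w = ∑ U (λ u → ⟦ B u w ⟧)

    -- The spine, q vertices of U, is visible only through `extend`. For a nonempty spine inside X,
    -- `shorter⁺` makes the pages strictly fewer than X, as an induction on |X| requires.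
    record BlueBook (q : ℕ) (U X : List V) : Set where
      field
        pages     : List V
        pages-⊆   : ∀ {w} → w ∈ pages → w ∈ X
        pages-uni : Unique pages
        shorter   : length pages ≤ length X
        shorter⁺  : q ≡ 0 ⊎ (∃ λ u → u ∈ U × length pages ≤ length (nbr B u X))
        extend    : ∀ {j} → Clique B j (_∈ pages) → Clique B (q + j) (λ v → v ∈ U ⊎ v ∈ X)

    open BlueBook

    -- The spine is chosen greedily, so that the moments of g drop by at most a factor |U| per vertex;
    -- the subtraction of q makes room for the chosen vertices, which leave U.
    blue-book : ∀ q m U X (g : V → ℕ) → Unique U → (∀ {u w} → u ∈ U → w ∈ U → u ≢ w → B u w ≡ true) →
      length U ≤ m → Unique X → (∀ {w} → w ∈ X → g w ≤ degB U w ∸ q) → 0 < ∑ X (λ w → g w ^ q) →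
      Σ (BlueBook q U X) λ bk → ∑ X (λ w → g w ^ q) ≤ length (pages bk) * m ^ q
    blue-book zero m U X g uU blue U≤m uX g≤ pos = bk , ≤-reflexive (∑-const X 1)
      where
      bk : BlueBook zero U X
      pages bk     = X
      pages-⊆ bk   = λ w∈ → w∈
      pages-uni bk = uX
      shorter bk   = ≤-refl
      shorter⁺ bk  = inj₁ refl
      extend bk    = clique-⊆ inj₂
    blue-book (suc q) m U X g uU blue U≤m uX g≤ pos
      with find-≤ U (λ _ → T) (λ u → length U * S u) nonempty averaging
      where
      T = ∑ X (λ w → g w ^ suc q)
      S : V → ℕ
      S u = ∑ (nbr B u X) (λ w → g w ^ q)
      -- Double counting of blue pairs between U and X: one factor g w of the moment is bounded by
      -- the blue degree of w into U.
      T≤ : T ≤ ∑ U S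
      T≤ = begin
        T                                                  ≤⟨ ∑-mono X (λ {w} w∈ → *-monoˡ-≤ (g w ^ q) (≤-trans (g≤ w∈) (m∸n≤m (degB U w) (suc q)))) ⟩
        ∑ X (λ w → degB U w * g w ^ q)                     ≡⟨ ∑-cong X (λ w → trans (*-comm (degB U w) _) (sym (∑-* U (g w ^ q) _))) ⟩
        ∑ X (λ w → ∑ U (λ u → g w ^ q * ⟦ B u w ⟧))        ≡⟨ ∑-swap X U _ ⟩
        ∑ U (λ u → ∑ X (λ w → g w ^ q * ⟦ B u w ⟧))        ≡⟨ ∑-cong U (λ u → trans (∑-cong X (λ w → *-comm (g w ^ q) _)) (sym (∑-filter (B u) X _))) ⟩
        ∑ U S                                              ∎
        where open ≤-Reasoning
      nonempty : 0 < length U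
      nonempty = helper U T≤
        where
        helper : ∀ U → T ≤ ∑ U S → 0 < length U
        helper []      h = ⊥-elim (<⇒≱ pos h)
        helper (_ ∷ _) h = s≤s z≤n
      averaging : ∑ U (λ _ → T) ≤ ∑ U (λ u → length U * S u)
      averaging = begin
        ∑ U (λ _ → T)               ≡⟨ ∑-const U T ⟩
        length U * T                ≤⟨ *-monoʳ-≤ (length U) T≤ ⟩
        length U * ∑ U S            ≡⟨ sym (∑-* U (length U) S) ⟩
        ∑ U (λ u → length U * S u)  ∎
        where open ≤-Reasoning
    ... | u , u∈ , Tu≤ with remove U u∈ uU
    ...   | U′ , uU′ , sub , len , sums
      with blue-book q m U′ (nbr B u X) g uU′
             (λ a∈ b∈ → blue (proj₁ (sub a∈)) (proj₁ (sub b∈)))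
             (≤-trans (n≤1+n _) (≤-trans (≤-reflexive (sym len)) U≤m))
             (Unique-filterᵇ (B u) X uX) g≤′ (pos′ {length U} (<-≤-trans pos Tu≤))
      where
      -- Deleting u lowers the degree of its blue neighbour w by exactly 1, which matches the drop
      -- of the subtracted number from q + 1 to q.
      g≤′ : ∀ {w} → w ∈ nbr B u X → g w ≤ degB U′ w ∸ q
      g≤′ {w} w∈ with ∈-filterᵇ (B u) X w∈
      ... | w∈X , buw = subst (λ z → g w ≤ z ∸ suc q)
        (trans (sums (λ u → ⟦ B u w ⟧)) (cong (λ z → ⟦ z ⟧ + degB U′ w) buw)) (g≤ w∈X)
      pos′ : ∀ {l s} → 0 < l * s → 0 < s
      pos′ {l} {zero} h = subst (0 <_) (*-zeroʳ l) h
      pos′ {l} {suc s} h = s≤s z≤n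
    ...     | bk′ , h = bk , (begin
        ∑ X (λ w → g w ^ suc q)                  ≤⟨ Tu≤ ⟩
        length U * ∑ (nbr B u X) (λ w → g w ^ q) ≤⟨ *-mono-≤ U≤m h ⟩
        m * (length (pages bk′) * m ^ q)         ≡⟨ shuffle m (length (pages bk′)) (m ^ q) ⟩
        length (pages bk′) * (m * m ^ q)         ∎)
      where
      open ≤-Reasoning
      shuffle : ∀ m l p → m * (l * p) ≡ l * (m * p)
      shuffle = solve-∀
      bk : BlueBook (suc q) U X
      pages bk     = pages bk′
      pages-⊆ bk   w∈ = proj₁ (∈-filterᵇ (B u) X (pages-⊆ bk′ w∈))
      pages-uni bk = pages-uni bk′
      shorter bk   = ≤-trans (shorter bk′) (length-filter-≤ (B u) X)
      shorter⁺ bk  = inj₂ (u , u∈ , shorter bk′)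
      extend bk K  = clique-∷ u (inj₁ u∈) step (extend bk′ K)
        where
        step : ∀ {w} → w ∈ U′ ⊎ w ∈ nbr B u X → (w ∈ U ⊎ w ∈ X) × B u w ≡ true
        step (inj₁ w∈) = inj₁ (proj₁ (sub w∈)) , blue u∈ (proj₁ (sub w∈)) (proj₂ (sub w∈))
        step (inj₂ w∈) = let w∈X , b = ∈-filterᵇ (B u) X w∈ in inj₂ w∈X , b

    -- Let q be the spine length. The mean of `degB U` over X is at least (γ + 1) q, and γ q remains
    -- after making room for the spine. By convexity the q-th moment is at least |X| (γ q)^q; as |U|
    -- = t q, a fraction (γ/t)^q of X survives as pages.
    dense-blue-book : ∀ q t γ U X → 0 < t → 0 < γ → Unique U → (∀ {u w} → u ∈ U → w ∈ U → u ≢ w → B u w ≡ true) →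
      length U ≡ t * suc q → Unique X → 0 < length X →
      (∀ {u} → u ∈ U → suc γ * length X ≤ t * length (nbr B u X)) →
      Σ (BlueBook (suc q) U X) λ bk → length X * γ ^ suc q ≤ length (pages bk) * t ^ suc q
    dense-blue-book q′ t γ U X t>0 γ>0 uU blue lenU uX X>0 high =
      proj₁ book , *-cancel-≤ (q ^ q) (^-pos q (s≤s z≤n)) (begin
        q ^ q * (length X * γ ^ q)               ≡⟨ e₁ (q ^ q) (length X) (γ ^ q) ⟩
        length X * (γ ^ q * q ^ q)               ≡⟨ cong (length X *_) (sym (^-distrib-* γ q q)) ⟩
        length X * (γ * q) ^ q                   ≤⟨ moment ⟩
        ∑ X (λ w → g w ^ q)                      ≤⟨ proj₂ book ⟩
        s * (t * q) ^ q                          ≡⟨ cong (s *_) (^-distrib-* t q q) ⟩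
        s * (t ^ q * q ^ q)                      ≡⟨ e₂ s (t ^ q) (q ^ q) ⟩
        q ^ q * (s * t ^ q)                      ∎)
      where
      open ≤-Reasoning
      q = suc q′
      g : V → ℕ
      g w = degB U w ∸ q
      e₁ : ∀ a b c → a * (b * c) ≡ b * (c * a)
      e₁ = solve-∀
      e₂ : ∀ a b c → a * (b * c) ≡ c * (a * b)
      e₂ = solve-∀
      degrees : t * (q * (suc γ * length X)) ≤ t * ∑ X (degB U)
      degrees = begin
        t * (q * (suc γ * length X))                ≡⟨ sym (*-assoc t q _) ⟩
        t * q * (suc γ * length X)                  ≡⟨ cong (_* (suc γ * length X)) (sym lenU) ⟩
        length U * (suc γ * length X)               ≡⟨ sym (∑-const U _) ⟩
        ∑ U (λ _ → suc γ * length X)                ≤⟨ ∑-mono U high ⟩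
        ∑ U (λ u → t * length (nbr B u X))          ≡⟨ ∑-* U t _ ⟩
        t * ∑ U (λ u → length (nbr B u X))          ≡⟨ cong (t *_) (∑-cong U (λ u → length-filter (B u) X)) ⟩
        t * ∑ U (λ u → ∑ X (λ w → ⟦ B u w ⟧))       ≡⟨ cong (t *_) (∑-swap U X _) ⟩
        t * ∑ X (degB U)                            ∎
      mean : length X * (γ * q) ≤ ∑ X g
      mean = +-cancelʳ-≤ (length X * q) _ _ (begin
        length X * (γ * q) + length X * q   ≡⟨ e₃ (length X) γ q ⟩
        q * (suc γ * length X)              ≤⟨ *-cancel-≤ t t>0 degrees ⟩
        ∑ X (degB U)                        ≤⟨ ∑-mono X (λ {w} _ → m≤n+m∸n (degB U w) q) ⟩
        ∑ X (λ w → q + g w)                 ≡⟨ trans (∑-+ X _ _) (cong (_+ ∑ X g) (∑-const X q)) ⟩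
        length X * q + ∑ X g                ≡⟨ +-comm (length X * q) _ ⟩
        ∑ X g + length X * q                ∎)
        where
        e₃ : ∀ x γ q → x * (γ * q) + x * q ≡ q * (suc γ * x)
        e₃ = solve-∀
      moment : length X * (γ * q) ^ q ≤ ∑ X (λ w → g w ^ q)
      moment = power-mean q′ (γ * q) X g mean
      book = blue-book q (t * q) U X g uU blue (≤-reflexive lenU) uX (λ _ → ≤-refl)
        (<-≤-trans (*-mono-≤ X>0 (^-pos q (*-mono-≤ γ>0 (s≤s z≤n)))) moment)
      s = length (pages (proj₁ book))

  -- Red edges and codegrees

  ∑-partition : {A : Set} (p : A → Bool) (xs : List A) (f : A → ℕ) →
    ∑ xs f ≡ ∑ (filterᵇ p xs) f + ∑ (filterᵇ (not ∘ p) xs) f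
  ∑-partition p []       f = refl
  ∑-partition p (x ∷ xs) f with p x
  ... | true  rewrite ∑-partition p xs f = sym (+-assoc (f x) _ _)
  ... | false rewrite ∑-partition p xs f = shuffle (f x) (∑ (filterᵇ p xs) f) _
    where
    shuffle : ∀ a b c → a + (b + c) ≡ b + (a + c)
    shuffle = solve-∀

  module _ {V : Set} (G : Graph V) where
    open Graph G

    -- Ordered pairs are counted, so X and Y may overlap; at the start of the book induction they
    -- coincide.
    edges : List V → List V → ℕ
    edges X Y = ∑ X (λ x → length (nbr R x Y))

    edges-≤ : ∀ X Y → edges X Y ≤ length X * length Y
    edges-≤ X Y = ≤-trans (∑-mono X (λ {x} _ → length-filter-≤ (R x) Y)) (≤-reflexive (∑-const X (length Y)))

    -- The sum on the right counts pairs of red edges from X that meet in Y, that is, the squares of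
    -- the red degrees D y; Cauchy-Schwarz does the rest.
    codegrees : ∀ X Y → edges X Y * edges X Y ≤ length Y * ∑ X (λ v → edges X (nbr R v Y))
    codegrees X Y = begin
      edges X Y * edges X Y                          ≡⟨ cong₂ _*_ edges≡ edges≡ ⟩
      ∑ Y D * ∑ Y D                                  ≤⟨ cauchy-schwarz Y D ⟩
      length Y * ∑ Y (λ y → D y * D y)               ≡⟨ cong (length Y *_) squares ⟩
      length Y * ∑ X (λ v → edges X (nbr R v Y))     ∎
      where
      open ≤-Reasoning
      D : V → ℕ
      D y = ∑ X (λ x → ⟦ R x y ⟧)
      edges≡ : edges X Y ≡ ∑ Y D
      edges≡ = trans (∑-cong X (λ x → length-filter (R x) Y)) (∑-swap X Y _)
      at : ∀ v → edges X (nbr R v Y) ≡ ∑ Y (λ y → ⟦ R v y ⟧ * D y)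
      at v = trans (∑-cong X (λ x → trans (length-filter (R x) (nbr R v Y)) (∑-filter (R v) Y _)))
        (trans (∑-swap X Y _) (∑-cong Y (λ y → ∑-* X ⟦ R v y ⟧ _)))
      squares : ∑ Y (λ y → D y * D y) ≡ ∑ X (λ v → edges X (nbr R v Y))
      squares = sym (trans (∑-cong X at) (trans (∑-swap X Y _)
        (∑-cong Y (λ y → trans (∑-cong X (λ v → *-comm ⟦ R v y ⟧ (D y)))
                               (∑-* X (D y) _)))))

    -- The last inequality says that, relative to the size of the second set, the excess of (X, N_R(v) ∩ Y)
    -- is at least 1 - 1/E times the excess F of (X, Y).
    good-vertex : ∀ t P E h F X Y (low : V → Bool) →
      0 < t → 0 < P → 0 < E → 0 < h → 0 < length X → 0 < length Y →
      t * edges X Y ≡ P * (length X * length Y) + F →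
      (∀ {v} → v ∈ X → P * length Y ≤ t * length (nbr R v Y)) →
      length (filterᵇ (not ∘ low) X) ≤ h →
      2 * E * (t * t) * h * length Y ≤ F →
      ∃ λ v → v ∈ X × low v ≡ true ×
        E * (t * edges X Y) * length (nbr R v Y) ≤ E * t * length Y * edges X (nbr R v Y) + F * length (nbr R v Y)
    good-vertex t P E h F X Y low t>0 P>0 E>0 h>0 x>0 y>0 density regular few W≤F
      with find-≤ L (λ v → E * (t * e) * d v) (λ v → E * t * y * co v + F * d v) L>0 main
      where
      open ≤-Reasoning
      x = length X
      y = length Y
      e = edges X Y
      d : V → ℕ
      d v = length (nbr R v Y)
      co : V → ℕ
      co v = edges X (nbr R v Y)
      L = filterᵇ low X
      H = filterᵇ (not ∘ low) X
      Et>0 : 0 < E * t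
      Et>0 = *-mono-≤ E>0 t>0
      -- Since F ≤ t |X| |Y|, the lower bound on F forces X to be this large; then at least half of
      -- X is low.
      2h≤x : 2 * h ≤ x
      2h≤x = *-cancel-≤ (t * y) (*-mono-≤ t>0 y>0) (begin
        t * y * (2 * h)              ≡⟨ e₁ t y h ⟩
        1 * (2 * h * t * y)          ≤⟨ *-monoˡ-≤ _ Et>0 ⟩
        E * t * (2 * h * t * y)      ≡⟨ e₂ E t h y ⟩
        2 * E * (t * t) * h * y      ≤⟨ W≤F ⟩
        F                            ≤⟨ m≤n+m F _ ⟩
        P * (x * y) + F              ≡⟨ sym density ⟩
        t * e                        ≤⟨ *-monoʳ-≤ t (edges-≤ X Y) ⟩
        t * (x * y)                  ≡⟨ e₃ t x y ⟩
        t * y * x                    ∎)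
        where
        e₁ : ∀ t y h → t * y * (2 * h) ≡ 1 * (2 * h * t * y)
        e₁ = solve-∀
        e₂ : ∀ E t h y → E * t * (2 * h * t * y) ≡ 2 * E * (t * t) * h * y
        e₂ = solve-∀
        e₃ : ∀ t x y → t * (x * y) ≡ t * y * x
        e₃ = solve-∀
      x≡L+H : x ≡ length L + length H
      x≡L+H = trans (length≡∑ G X) (trans (∑-partition low X (λ _ → 1))
                (cong₂ _+_ (sym (length≡∑ G L)) (sym (length≡∑ G H))))
      x≤2L : x ≤ 2 * length L
      x≤2L = +-cancelʳ-≤ (2 * h) _ _ (begin
        x + 2 * h                ≤⟨ +-monoʳ-≤ x 2h≤x ⟩
        x + x                    ≤⟨ +-mono-≤ x≤L+h x≤L+h ⟩
        length L + h + (length L + h) ≡⟨ e₄ (length L) h ⟩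
        2 * length L + 2 * h     ∎)
        where
        x≤L+h : x ≤ length L + h
        x≤L+h = ≤-trans (≤-reflexive x≡L+H) (+-monoʳ-≤ (length L) few)
        e₄ : ∀ l h → l + h + (l + h) ≡ 2 * l + 2 * h
        e₄ = solve-∀
      L>0 : 0 < length L
      L>0 with length L in eq
      ... | zero  = ⊥-elim (<⇒≱ x>0 (subst (λ z → x ≤ 2 * z) eq x≤2L))
      ... | suc _ = s≤s z≤n
      -- The high vertices contribute at most h |X| |Y| to the codegree sum. The size of F and the
      -- red degrees of the low vertices pay for this.
      exceptional : E * t * y * ∑ H co ≤ F * ∑ L d
      exceptional = *-cancel-≤ t t>0 (begin
        t * (E * t * y * ∑ H co)             ≤⟨ *-monoʳ-≤ t (*-monoʳ-≤ (E * t * y) coH) ⟩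
        t * (E * t * y * (h * (x * y)))      ≤⟨ *-monoʳ-≤ t (*-monoʳ-≤ (E * t * y) (*-monoʳ-≤ h (*-monoˡ-≤ y x≤2L))) ⟩
        t * (E * t * y * (h * (2 * length L * y))) ≡⟨ e₅ t E y h (length L) ⟩
        2 * E * (t * t) * h * y * (length L * (1 * y)) ≤⟨ *-mono-≤ W≤F (*-monoʳ-≤ (length L) (*-monoˡ-≤ y P>0)) ⟩
        F * (length L * (P * y))             ≡⟨ cong (F *_) (sym (∑-const L (P * y))) ⟩
        F * ∑ L (λ _ → P * y)                ≤⟨ *-monoʳ-≤ F (∑-mono L (λ v∈ → regular (proj₁ (∈-filterᵇ low X v∈)))) ⟩
        F * ∑ L (λ v → t * d v)              ≡⟨ cong (F *_) (∑-* L t d) ⟩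
        F * (t * ∑ L d)                      ≡⟨ e₆ F t (∑ L d) ⟩
        t * (F * ∑ L d)                      ∎)
        where
        coH : ∑ H co ≤ h * (x * y)
        coH = begin
          ∑ H co                 ≤⟨ ∑-mono H (λ {v} _ → ≤-trans (edges-≤ X (nbr R v Y)) (*-monoʳ-≤ x (length-filter-≤ (R v) Y))) ⟩
          ∑ H (λ _ → x * y)      ≡⟨ ∑-const H _ ⟩
          length H * (x * y)     ≤⟨ *-monoˡ-≤ _ few ⟩
          h * (x * y)            ∎
        e₅ : ∀ t E y h l → t * (E * t * y * (h * (2 * l * y))) ≡ 2 * E * (t * t) * h * y * (l * (1 * y))
        e₅ = solve-∀
        e₆ : ∀ F t s → F * (t * s) ≡ t * (F * s)
        e₆ = solve-∀
      main : ∑ L (λ v → E * (t * e) * d v) ≤ ∑ L (λ v → E * t * y * co v + F * d v)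
      main = begin
        ∑ L (λ v → E * (t * e) * d v)        ≡⟨ ∑-* L (E * (t * e)) d ⟩
        E * (t * e) * ∑ L d                  ≤⟨ *-monoʳ-≤ (E * (t * e)) (≤-trans (m≤m+n _ _) (≤-reflexive (sym (∑-partition low X d)))) ⟩
        E * (t * e) * e                      ≡⟨ e₇ E t e ⟩
        E * t * (e * e)                      ≤⟨ *-monoʳ-≤ (E * t) (codegrees X Y) ⟩
        E * t * (y * ∑ X co)                 ≡⟨ cong (λ z → E * t * (y * z)) (∑-partition low X co) ⟩
        E * t * (y * (∑ L co + ∑ H co))      ≡⟨ e₈ (E * t) y (∑ L co) (∑ H co) ⟩
        E * t * y * ∑ L co + E * t * y * ∑ H co ≤⟨ +-monoʳ-≤ (E * t * y * ∑ L co) exceptional ⟩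
        E * t * y * ∑ L co + F * ∑ L d       ≡⟨ sym (cong₂ _+_ (∑-* L (E * t * y) co) (∑-* L F d)) ⟩
        ∑ L (λ v → E * t * y * co v) + ∑ L (λ v → F * d v) ≡⟨ sym (∑-+ L _ _) ⟩
        ∑ L (λ v → E * t * y * co v + F * d v) ∎
        where
        e₇ : ∀ E t e → E * (t * e) * e ≡ E * t * (e * e)
        e₇ = solve-∀
        e₈ : ∀ k y a b → k * (y * (a + b)) ≡ k * y * a + k * y * b
        e₈ = solve-∀
    ... | v , v∈ , good = let v∈X , lo = ∈-filterᵇ low X v∈ in v , v∈X , lo , good

  -- Behaviour of the potential under the steps of the induction

  -- With M = n + 1 and x = x′ + 1, F′/F is at least the mean of n copies of x′/x and one 1. By
  -- AM-GM its M-th power is at least (x′/x)^n, so F^M / (x y)^n does not drop.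
  removal-step : ∀ n K L x′ y F F′ → K * (suc x′ * y) ^ n ≤ L * F ^ suc n →
    (n * x′ + suc x′) * F ≤ suc n * suc x′ * F′ → K * (x′ * y) ^ n ≤ L * F′ ^ suc n
  removal-step n K L x′ y F F′ pot excess =
    *-cancel-≤ (x ^ M * M ^ M) (*-mono-≤ (^-pos M (s≤s z≤n)) (^-pos M (s≤s z≤n))) (begin
    x ^ M * M ^ M * (K * (x′ * y) ^ n)             ≡⟨ cong (λ z → x ^ M * M ^ M * (K * z)) (^-distrib-* x′ y n) ⟩
    x * x ^ n * M ^ M * (K * (x′ ^ n * y ^ n))     ≡⟨ e₁ x (x ^ n) (M ^ M) K (x′ ^ n) (y ^ n) ⟩
    K * (x ^ n * y ^ n) * (x * x′ ^ n * M ^ M)     ≡⟨ cong (λ z → K * z * (x * x′ ^ n * M ^ M)) (sym (^-distrib-* x y n)) ⟩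
    K * (x * y) ^ n * (x * x′ ^ n * M ^ M)         ≤⟨ *-mono-≤ pot (amgm n x x′) ⟩
    L * F ^ M * (n * x′ + x) ^ M                   ≡⟨ e₂ L (F ^ M) ((n * x′ + x) ^ M) ⟩
    L * ((n * x′ + x) ^ M * F ^ M)                 ≡⟨ cong (L *_) (sym (^-distrib-* (n * x′ + x) F M)) ⟩
    L * ((n * x′ + x) * F) ^ M                     ≤⟨ *-monoʳ-≤ L (^-mono-≤ M excess) ⟩
    L * (M * x * F′) ^ M                           ≡⟨ cong (L *_) (trans (^-distrib-* (M * x) F′ M) (cong (_* F′ ^ M) (^-distrib-* M x M))) ⟩
    L * (M ^ M * x ^ M * F′ ^ M)                   ≡⟨ e₃ L (M ^ M) (x ^ M) (F′ ^ M) ⟩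
    x ^ M * M ^ M * (L * F′ ^ M)                   ∎)
    where
    open ≤-Reasoning
    x = suc x′
    M = suc n
    e₁ : ∀ x p m K q r → x * p * m * (K * (q * r)) ≡ K * (p * r) * (x * q * m)
    e₁ = solve-∀
    e₂ : ∀ L p q → L * p * q ≡ L * (q * p)
    e₂ = solve-∀
    e₃ : ∀ L m x f → L * (m * x * f) ≡ x * m * (L * f)
    e₃ = solve-∀

  -- With M = n + 1, F^M shrinks by (s/x)^M but (x y)^n by (s/x)^n, so shrinking X costs a single
  -- factor s/x, at least γq/tq. The further factor (n/M)^M is the loss in `excess`; the gap between
  -- cq and γq pays for it.
  blue-book-step : ∀ n K L x y s F F′ tq cq γq → 0 < x → 0 < cq →
    K * tq * (x * y) ^ n ≤ L * cq * F ^ suc n → x * γq ≤ s * tq → s * n * F ≤ suc n * x * F′ →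
    cq * suc n ^ suc n ≤ γq * n ^ suc n → K * (s * y) ^ n ≤ L * F′ ^ suc n
  blue-book-step n K L x y s F F′ tq cq γq x>0 cq>0 pot large excess cost =
    *-cancel-≤ (cq * x ^ M * M ^ M) (*-mono-≤ (*-mono-≤ cq>0 (^-pos M x>0)) (^-pos M (s≤s z≤n))) (begin
    cq * x ^ M * M ^ M * (K * (s * y) ^ n)                 ≡⟨ cong (λ z → cq * x ^ M * M ^ M * (K * z)) (^-distrib-* s y n) ⟩
    cq * (x * x ^ n) * M ^ M * (K * (s ^ n * y ^ n))       ≡⟨ e₁ cq x (x ^ n) (M ^ M) K (s ^ n) (y ^ n) ⟩
    K * (s ^ n * y ^ n) * x ^ n * x * (cq * M ^ M)         ≤⟨ *-monoʳ-≤ (K * (s ^ n * y ^ n) * x ^ n * x) cost ⟩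
    K * (s ^ n * y ^ n) * x ^ n * x * (γq * n ^ M)         ≡⟨ e₂ (K * (s ^ n * y ^ n) * x ^ n) x γq (n ^ M) ⟩
    K * (s ^ n * y ^ n) * x ^ n * n ^ M * (x * γq)         ≤⟨ *-monoʳ-≤ (K * (s ^ n * y ^ n) * x ^ n * n ^ M) large ⟩
    K * (s ^ n * y ^ n) * x ^ n * n ^ M * (s * tq)         ≡⟨ e₃ K (s ^ n) (y ^ n) (x ^ n) (n ^ M) s tq ⟩
    K * tq * (x ^ n * y ^ n) * (s * s ^ n * n ^ M)         ≡⟨ cong (λ z → K * tq * z * (s * s ^ n * n ^ M)) (sym (^-distrib-* x y n)) ⟩
    K * tq * (x * y) ^ n * (s ^ M * n ^ M)                 ≤⟨ *-monoˡ-≤ (s ^ M * n ^ M) pot ⟩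
    L * cq * F ^ M * (s ^ M * n ^ M)                       ≡⟨ e₄ L cq (F ^ M) (s ^ M) (n ^ M) ⟩
    L * cq * (s ^ M * n ^ M * F ^ M)                       ≡⟨ cong (L * cq *_) (sym (trans (^-distrib-* (s * n) F M) (cong (_* F ^ M) (^-distrib-* s n M)))) ⟩
    L * cq * (s * n * F) ^ M                               ≤⟨ *-monoʳ-≤ (L * cq) (^-mono-≤ M excess) ⟩
    L * cq * (M * x * F′) ^ M                              ≡⟨ cong (L * cq *_) (trans (^-distrib-* (M * x) F′ M) (cong (_* F′ ^ M) (^-distrib-* M x M))) ⟩
    L * cq * (M ^ M * x ^ M * F′ ^ M)                      ≡⟨ e₅ L cq (M ^ M) (x ^ M) (F′ ^ M) ⟩
    cq * x ^ M * M ^ M * (L * F′ ^ M)                      ∎)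
    where
    open ≤-Reasoning
    M = suc n
    e₁ : ∀ cq x xn m K sn yn → cq * (x * xn) * m * (K * (sn * yn)) ≡ K * (sn * yn) * xn * x * (cq * m)
    e₁ = solve-∀
    e₂ : ∀ k x g n → k * x * (g * n) ≡ k * n * (x * g)
    e₂ = solve-∀
    e₃ : ∀ K sn yn xn nm s tq → K * (sn * yn) * xn * nm * (s * tq) ≡ K * tq * (xn * yn) * (s * sn * nm)
    e₃ = solve-∀
    e₄ : ∀ L c f s n → L * c * f * (s * n) ≡ L * c * (s * n * f)
    e₄ = solve-∀
    e₅ : ∀ L c m x f → L * c * (m * x * f) ≡ c * x * m * (L * f)
    e₅ = solve-∀

  -- Once F ≤ W y, the potential F^M / (x y)^n, M = n + 1, is at most W^M y, so it becomes a lower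
  -- bound for |Y|.
  stopping-step : ∀ n K L x y F W → 0 < x → 0 < y → K * (x * y) ^ n ≤ L * F ^ suc n → F ≤ W * y →
    K ≤ L * (W ^ suc n * y)
  stopping-step n K L x y F W x>0 y>0 pot small = *-cancel-≤ (y ^ n) (^-pos n y>0) (begin
    y ^ n * K                        ≡⟨ e₁ (y ^ n) K ⟩
    K * (1 * y ^ n)                  ≤⟨ *-monoʳ-≤ K (*-monoˡ-≤ (y ^ n) (^-pos n x>0)) ⟩
    K * (x ^ n * y ^ n)              ≡⟨ cong (K *_) (sym (^-distrib-* x y n)) ⟩
    K * (x * y) ^ n                  ≤⟨ pot ⟩
    L * F ^ suc n                    ≤⟨ *-monoʳ-≤ L (^-mono-≤ (suc n) small) ⟩
    L * (W * y) ^ suc n              ≡⟨ cong (L *_) (^-distrib-* W y (suc n)) ⟩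
    L * (W ^ suc n * (y * y ^ n))    ≡⟨ e₂ L (W ^ suc n) y (y ^ n) ⟩
    y ^ n * (L * (W ^ suc n * y))    ∎)
    where
    open ≤-Reasoning
    e₁ : ∀ a K → a * K ≡ K * (1 * a)
    e₁ = solve-∀
    e₂ : ∀ L w y q → L * (w * (y * q)) ≡ q * (L * (w * y))
    e₂ = solve-∀

  vertex-step : ∀ n K L t a x y r z F F′ → 0 < a → 0 < F → t * K * (x * y) ^ n ≤ L * a * F ^ suc n →
    a * F ^ suc n * (r * z) ^ n ≤ t * F′ ^ suc n * (x * y) ^ n → K * (r * z) ^ n ≤ L * F′ ^ suc n
  vertex-step n K L t a x y r z F F′ a>0 F>0 pot ratio =
    *-cancel-≤ (a * F ^ suc n) (*-mono-≤ a>0 (^-pos (suc n) F>0)) (begin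
    a * F ^ suc n * (K * (r * z) ^ n)             ≡⟨ e₁ (a * F ^ suc n) K ((r * z) ^ n) ⟩
    K * (a * F ^ suc n * (r * z) ^ n)             ≤⟨ *-monoʳ-≤ K ratio ⟩
    K * (t * F′ ^ suc n * (x * y) ^ n)            ≡⟨ e₂ K t (F′ ^ suc n) ((x * y) ^ n) ⟩
    t * K * (x * y) ^ n * F′ ^ suc n              ≤⟨ *-monoˡ-≤ (F′ ^ suc n) pot ⟩
    L * a * F ^ suc n * F′ ^ suc n                ≡⟨ e₃ L a (F ^ suc n) (F′ ^ suc n) ⟩
    a * F ^ suc n * (L * F′ ^ suc n)              ∎)
    where
    open ≤-Reasoning
    e₁ : ∀ a K r → a * (K * r) ≡ K * (a * r)
    e₁ = solve-∀
    e₂ : ∀ K t f x → K * (t * f * x) ≡ t * K * x * f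
    e₂ = solve-∀
    e₃ : ∀ L a f g → L * a * f * g ≡ a * f * (L * g)
    e₃ = solve-∀

  -- If a step to (X′, N_R(v) ∩ Y) with |X′| = r does not pay for its factor a/t, the excess F′ of the pair
  -- is bounded by the tangent line at r = (β/t) |X| of a concave function of r.
  tangent-bound : ∀ n t P a β A E x y r z F F′ → 0 < t → 0 < P →
    t * F′ ^ suc n * (x * y) ^ n ≤ a * F ^ suc n * (r * z) ^ n → P * y ≤ t * z →
    a * (t * E ^ suc n) ≤ P * β * A ^ suc n →
    t * F′ * x * y * E * suc n ≤ A * F * z * (n * (t * r) + β * x)
  tangent-bound n t P a β A E x y r z F F′ t>0 P>0 fails degree cost =
    ^-cancel-≤ n (*-cancel-≤ (P * t) (*-mono-≤ P>0 t>0) (begin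
    P * t * (t * F′ * x * y * E * M) ^ M
      ≡⟨ cong (P * t *_) (trans (^-distrib-* (t * F′ * x * y * E) M M) (cong (_* M ^ M)
          (trans (^-distrib-* (t * F′ * x * y) E M) (cong (_* E ^ M)
          (trans (^-distrib-* (t * F′ * x) y M) (cong (_* y ^ M)
          (trans (^-distrib-* (t * F′) x M) (cong (_* x ^ M) (^-distrib-* t F′ M))))))))) ⟩
    P * t * (t * t ^ n * F′ ^ M * (x * x ^ n) * (y * y ^ n) * E ^ M * M ^ M)
      ≡⟨ e₁ P t (t ^ n) (F′ ^ M) x (x ^ n) y (y ^ n) (E ^ M) (M ^ M) ⟩
    t * F′ ^ M * (x ^ n * y ^ n) * (P * t * t ^ n * x * y * E ^ M * M ^ M)
      ≡⟨ cong (λ w → t * F′ ^ M * w * (P * t * t ^ n * x * y * E ^ M * M ^ M)) (sym (^-distrib-* x y n)) ⟩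
    t * F′ ^ M * (x * y) ^ n * (P * t * t ^ n * x * y * E ^ M * M ^ M)
      ≤⟨ *-monoˡ-≤ (P * t * t ^ n * x * y * E ^ M * M ^ M) fails ⟩
    a * F ^ M * (r * z) ^ n * (P * t * t ^ n * x * y * E ^ M * M ^ M)
      ≡⟨ cong (λ w → a * F ^ M * w * (P * t * t ^ n * x * y * E ^ M * M ^ M)) (^-distrib-* r z n) ⟩
    a * F ^ M * (r ^ n * z ^ n) * (P * t * t ^ n * x * y * E ^ M * M ^ M)
      ≡⟨ e₂ a (F ^ M) (r ^ n) (z ^ n) P t (t ^ n) x y (E ^ M) (M ^ M) ⟩
    a * (t * E ^ M) * (P * y) * (F ^ M * r ^ n * z ^ n * t ^ n * x * M ^ M)
      -- Since z/y ≥ P/t, the power (z/y)^n is at most (t/P) (z/y)^M; the factor t/P is included in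
      -- `cost`.
      ≤⟨ *-monoˡ-≤ (F ^ M * r ^ n * z ^ n * t ^ n * x * M ^ M) (*-mono-≤ cost degree) ⟩
    P * β * A ^ M * (t * z) * (F ^ M * r ^ n * z ^ n * t ^ n * x * M ^ M)
      ≡⟨ e₃ P β (A ^ M) t z (F ^ M) (r ^ n) (z ^ n) (t ^ n) x (M ^ M) ⟩
    P * t * (A ^ M * F ^ M * (z * z ^ n) * (β * x * (t ^ n * r ^ n) * M ^ M))
      ≡⟨ cong (λ w → P * t * (A ^ M * F ^ M * (z * z ^ n) * (β * x * w * M ^ M))) (sym (^-distrib-* t r n)) ⟩
    P * t * (A ^ M * F ^ M * z ^ M * (β * x * (t * r) ^ n * M ^ M))
      ≤⟨ *-monoʳ-≤ (P * t) (*-monoʳ-≤ (A ^ M * F ^ M * z ^ M) (amgm n (β * x) (t * r))) ⟩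
    P * t * (A ^ M * F ^ M * z ^ M * (n * (t * r) + β * x) ^ M)
      ≡⟨ cong (P * t *_) (sym (trans (^-distrib-* (A * F * z) _ M) (cong (_* (n * (t * r) + β * x) ^ M)
          (trans (^-distrib-* (A * F) z M) (cong (_* z ^ M) (^-distrib-* A F M)))))) ⟩
    P * t * (A * F * z * (n * (t * r) + β * x)) ^ M ∎))
    where
    open ≤-Reasoning
    M = suc n
    e₁ : ∀ P t tn f x xn y yn e m → P * t * (t * tn * f * (x * xn) * (y * yn) * e * m) ≡
         t * f * (xn * yn) * (P * t * tn * x * y * e * m)
    e₁ = solve-∀
    e₂ : ∀ a f rn zn P t tn x y e m → a * f * (rn * zn) * (P * t * tn * x * y * e * m) ≡
         a * (t * e) * (P * y) * (f * rn * zn * tn * x * m)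
    e₂ = solve-∀
    e₃ : ∀ P β A t z f rn zn tn x m → P * β * A * (t * z) * (f * rn * zn * tn * x * m) ≡
         P * t * (A * f * (z * zn) * (β * x * (tn * rn) * m))
    e₃ = solve-∀

  -- Relative to the second set, the two neighbourhoods of v keep all but a fraction 2/E of the
  -- excess: one 1/E is lost in `good`, the other covers the at most z red edges at v itself.
  excess-split : ∀ t P E x y z e co F F₁ F₂ → t * e ≡ P * (x * y) + F →
    E * (t * e) * z ≤ E * t * y * co + F * z → t * co ≤ P * (x * z) + F₁ + F₂ + t * z →
    E * t * y ≤ F → E * F * z ≤ E * y * (F₁ + F₂) + 2 * (F * z)
  excess-split t P E x y z e co F F₁ F₂ density good split large =
    +-cancelˡ-≤ (E * P * x * y * z) _ _ (begin
    E * P * x * y * z + E * F * z                ≡⟨ e₁ E P x y z F ⟩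
    E * (P * (x * y) + F) * z                    ≡⟨ cong (λ w → E * w * z) (sym density) ⟩
    E * (t * e) * z                              ≤⟨ good ⟩
    E * t * y * co + F * z                       ≡⟨ e₂ E t y co (F * z) ⟩
    E * y * (t * co) + F * z                     ≤⟨ +-monoˡ-≤ (F * z) (*-monoʳ-≤ (E * y) split) ⟩
    E * y * (P * (x * z) + F₁ + F₂ + t * z) + F * z ≡⟨ e₃ E y P x z F₁ F₂ t (F * z) ⟩
    E * P * x * y * z + E * y * (F₁ + F₂) + E * t * y * z + F * z
      ≤⟨ +-monoˡ-≤ (F * z) (+-monoʳ-≤ (E * P * x * y * z + E * y * (F₁ + F₂)) (*-monoˡ-≤ z large)) ⟩
    E * P * x * y * z + E * y * (F₁ + F₂) + F * z + F * z ≡⟨ e₄ (E * P * x * y * z) (E * y * (F₁ + F₂)) (F * z) ⟩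
    E * P * x * y * z + (E * y * (F₁ + F₂) + 2 * (F * z)) ∎)
    where
    open ≤-Reasoning
    e₁ : ∀ E P x y z F → E * P * x * y * z + E * F * z ≡ E * (P * (x * y) + F) * z
    e₁ = solve-∀
    e₂ : ∀ E t y c f → E * t * y * c + f ≡ E * y * (t * c) + f
    e₂ = solve-∀
    e₃ : ∀ E y P x z a b t f → E * y * (P * (x * z) + a + b + t * z) + f ≡
         E * P * x * y * z + E * y * (a + b) + E * t * y * z + f
    e₃ = solve-∀
    e₄ : ∀ p q f → p + q + f + f ≡ p + (q + 2 * f)
    e₄ = solve-∀

  -- The tangent points β′/t and β/t add up to 1. As r + b ≤ x and b ≤ (β/t) x, the two tangent
  -- bounds sum to at most (A + Δ β/t)/E times F z/y. This is the mean of the two slopes with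
  -- weights β′/t and β/t, and `slack` puts it below 1 - 2/E.
  no-step-fails : ∀ n t β β′ A Δ E x y r b z F F₁ F₂ → β + β′ ≡ t → A * t + Δ * β + 2 * t < E * t →
    0 < x → 0 < z → 0 < F → r + b ≤ x → t * b ≤ β * x →
    t * F₁ * x * y * E * suc n ≤ A * F * z * (n * (t * r) + β′ * x) →
    t * F₂ * x * y * E * suc n ≤ (A + Δ) * F * z * (n * (t * b) + β * x) →
    E * F * z ≤ E * y * (F₁ + F₂) + 2 * (F * z) → ⊥
  no-step-fails n t β β′ A Δ E x y r b z F F₁ F₂ refl slack x>0 z>0 F>0 r+b≤x few red blue split =
    <-irrefl refl (begin-strict
    t * x * M * (E * F * z)                         ≤⟨ *-monoʳ-≤ (t * x * M) split ⟩
    t * x * M * (E * y * (F₁ + F₂) + 2 * (F * z))   ≡⟨ e₁ t x M E y F₁ F₂ (F * z) ⟩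
    t * F₁ * x * y * E * M + t * F₂ * x * y * E * M + 2 * t * x * M * (F * z)
      ≤⟨ +-monoˡ-≤ (2 * t * x * M * (F * z)) (+-mono-≤ red blue) ⟩
    A * F * z * (n * (t * r) + β′ * x) + (A + Δ) * F * z * (n * (t * b) + β * x) + 2 * t * x * M * (F * z)
      ≡⟨ e₂ A F z n t r β′ x Δ b β M ⟩
    F * z * (n * (A * t * (r + b) + Δ * (t * b)) + x * (A * (β + β′) + Δ * β) + x * M * (2 * t))
      ≤⟨ *-monoʳ-≤ (F * z) (+-monoˡ-≤ (x * M * (2 * t)) (+-monoˡ-≤ (x * (A * (β + β′) + Δ * β))
          (*-monoʳ-≤ n (+-mono-≤ (*-monoʳ-≤ (A * t) r+b≤x) (*-monoʳ-≤ Δ few))))) ⟩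
    F * z * (n * (A * t * x + Δ * (β * x)) + x * (A * (β + β′) + Δ * β) + x * M * (2 * t))
      ≡⟨ e₃ F z n A β β′ x Δ ⟩
    F * z * x * M * (A * t + Δ * β + 2 * t)
      <⟨ *-monoʳ-< (F * z * x * M) {{>-nonZero (*-mono-≤ (*-mono-≤ (*-mono-≤ F>0 z>0) x>0) (s≤s {0} {n} z≤n))}} slack ⟩
    F * z * x * M * (E * t)                         ≡⟨ e₄ F z x M E t ⟩
    t * x * M * (E * F * z)                         ∎)
    where
    open ≤-Reasoning
    M = suc n
    e₁ : ∀ t x M E y a b f → t * x * M * (E * y * (a + b) + 2 * f) ≡
         t * a * x * y * E * M + t * b * x * y * E * M + 2 * t * x * M * f
    e₁ = solve-∀
    e₂ : ∀ A F z n t r β′ x Δ b β M →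
         A * F * z * (n * (t * r) + β′ * x) + (A + Δ) * F * z * (n * (t * b) + β * x) + 2 * t * x * M * (F * z) ≡
         F * z * (n * (A * t * (r + b) + Δ * (t * b)) + x * (A * (β + β′) + Δ * β) + x * M * (2 * t))
    e₂ = solve-∀
    e₃ : ∀ F z n A β β′ x Δ →
         F * z * (n * (A * (β + β′) * x + Δ * (β * x)) + x * (A * (β + β′) + Δ * β) + x * suc n * (2 * (β + β′))) ≡
         F * z * x * suc n * (A * (β + β′) + Δ * β + 2 * (β + β′))
    e₃ = solve-∀
    e₄ : ∀ F z x M E t → F * z * x * M * (E * t) ≡ t * x * M * (E * F * z)
    e₄ = solve-∀

  -- The book induction

  ∸-excess : ∀ k p m f → k * p + f ≤ k * m → f ≤ k * (m ∸ p)
  ∸-excess k p m f h = subst (f ≤_) (sym (*-distribˡ-∸ k m p)) (m+n≤o⇒n≤o∸m (k * p) h)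
    where
    m+n≤o⇒n≤o∸m : ∀ m {n o} → m + n ≤ o → n ≤ o ∸ m
    m+n≤o⇒n≤o∸m m {n} {o} h = subst (_≤ o ∸ m) (m+n∸m≡n m n) (∸-monoˡ-≤ m h)

  -- Each new excess is introduced by truncated subtraction; once it is known to be positive,
  -- nothing was truncated.
  ∸-exact : ∀ m p → 0 < m ∸ p → m ≡ p + (m ∸ p)
  ∸-exact m p h = sym (m+[n∸m]≡n (<⇒≤ (m<n⇒0<n∸m⁻¹ m p h)))
    where
    m<n⇒0<n∸m⁻¹ : ∀ m p → 0 < m ∸ p → p < m
    m<n⇒0<n∸m⁻¹ m p h with m ≤? p
    ... | yes m≤p = ⊥-elim (<-irrefl (sym (m≤n⇒m∸n≡0 m≤p)) h)
    ... | no m≰p  = ≰⇒> m≰p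

  *-pos-right : ∀ m {n} → 0 < m * n → 0 < n
  *-pos-right m {zero}  h = subst (0 <_) (*-zeroʳ m) h
  *-pos-right m {suc n} h = s≤s z≤n

  *-pos-left : ∀ {m} n → 0 < m * n → 0 < m
  *-pos-left {suc m} n h = s≤s z≤n

  -- With M = n + 1: p = P/t, blue degrees above (γ + 1)/t |X| count as high, A/E and (A + Δ)/E are the tangent
  -- slopes in the red and the blue direction, and the spine of a blue book has q + 1 vertices.  A red step may
  -- multiply the potential by a/t, and each new blue vertex by c/t.
  record Parameters {V : Set} (G : Graph V) : Set where
    open Graph G
    field
      t P β′ γ A Δ E n a c q h K₁ K₂ k₀ ℓ₀ : ℕ
      t>0 : 0 < t
      P>0 : 0 < P
      γ>0 : 0 < γ
      E>0 : 0 < E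
      n>0 : 0 < n
      a>0 : 0 < a
      c>0 : 0 < c
      h>0 : 0 < h
      c≤t : c ≤ t
      β-sum : suc γ + β′ ≡ t
      red-cost : a * (t * E ^ suc n) ≤ P * β′ * A ^ suc n
      blue-cost : c * (t * E ^ suc n) ≤ P * suc γ * (A + Δ) ^ suc n
      book-cost : c ^ suc q * suc n ^ suc n ≤ γ ^ suc q * n ^ suc n
      slack : A * t + Δ * suc γ + 2 * t < E * t

    -- The threshold for F / |Y| above which `good-vertex` applies; below it the induction stops and
    -- `finish` takes over.
    W : ℕ
    W = 2 * E * (t * t) * h

    field
      ramsey : ∀ H → Unique H → h ≤ length H → Clique R k₀ (_∈ H) ⊎ Clique B (t * suc q) (_∈ H)
      finish : ∀ k Y → k ≤ k₀ → Unique Y → t ^ k * K₁ ≤ K₂ * (a ^ k * (W ^ suc n * length Y)) →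
               Clique R k (_∈ Y) ⊎ Clique B ℓ₀ (_∈ Y)

  module Book {V : Set} (G : Graph V) (𝒫 : Parameters G) where
    open Graph G
    open Parameters 𝒫

    -- Blue vertices are collected in X only, so ℓ counts down there, while the blue target ℓ₀
    -- inside Y stays fixed.
    Outcome : ℕ → ℕ → List V → List V → Set
    Outcome k ℓ X Y = Clique R k (λ v → v ∈ X ⊎ v ∈ Y) ⊎ Clique B ℓ (_∈ X) ⊎ Clique B ℓ₀ (_∈ Y)

    Excess : List V → List V → ℕ → Set
    Excess X Y F = t * edges G X Y ≡ P * (length X * length Y) + F

    -- K₁/K₂ (t/a)^k (t/c)^ℓ ≤ F^M / (|X| |Y|)^n, where F = t |X| |Y| e.
    Potential : ℕ → ℕ → List V → List V → ℕ → Set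
    Potential k ℓ X Y F =
      t ^ (k + ℓ) * K₁ * (length X * length Y) ^ n ≤ K₂ * (a ^ k * c ^ ℓ) * F ^ suc n

    excess-pos : ∀ {X Y F} → 0 < F → Excess X Y F → 0 < length X * length Y
    excess-pos {X} {Y} {F} F>0 exc =
      <-≤-trans (*-pos-right t (<-≤-trans F>0 (≤-trans (m≤n+m F _) (≤-reflexive (sym exc))))) (edges-≤ G X Y)

    outcome-⊆ : ∀ {k ℓ X X′ Y} → (∀ {v} → v ∈ X′ → v ∈ X) → Outcome k ℓ X′ Y → Outcome k ℓ X Y
    outcome-⊆ sub (inj₁ K) = inj₁ (clique-⊆ (λ { (inj₁ p) → inj₁ (sub p) ; (inj₂ p) → inj₂ p }) K)
    outcome-⊆ sub (inj₂ (inj₁ K)) = inj₂ (inj₁ (clique-⊆ sub K))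
    outcome-⊆ sub (inj₂ (inj₂ K)) = inj₂ (inj₂ K)

    blue-all : ∀ vs → AllPairs (λ v w → B v w ≡ true) vs → ∀ {u w} → u ∈ vs → w ∈ vs → u ≢ w → B u w ≡ true
    blue-all (v ∷ vs) (b ∷ bs) (here refl) (here refl) u≢w = ⊥-elim (u≢w refl)
    blue-all (v ∷ vs) (b ∷ bs) (here refl) (there w∈)  u≢w = All.lookup b w∈
    blue-all (v ∷ vs) (b ∷ bs) (there u∈)  (here refl) u≢w = trans (B-sym _ _) (All.lookup b u∈)
    blue-all (v ∷ vs) (b ∷ bs) (there u∈)  (there w∈)  u≢w = blue-all vs bs u∈ w∈ u≢w

    blue-unique : ∀ {vs} → AllPairs (λ v w → B v w ≡ true) vs → Unique vs
    blue-unique = AllPairs.map λ { {v} b refl → contra (trans (sym b) (B-irrefl v)) }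
      where
      contra : true ≢ false
      contra ()

    stop : ∀ k ℓ X Y F → k ≤ k₀ → Unique Y → 0 < length X → 0 < length Y → Potential k ℓ X Y F →
      F ≤ W * length Y → Outcome k ℓ X Y
    stop k ℓ X Y F k≤ uY x>0 y>0 pot small
      with finish k Y k≤ uY (*-cancel-≤ (t ^ ℓ) (^-pos ℓ t>0) (begin
        t ^ ℓ * (t ^ k * K₁)                       ≡⟨ e₁ (t ^ ℓ) (t ^ k) K₁ ⟩
        t ^ k * t ^ ℓ * K₁                         ≡⟨ cong (_* K₁) (sym (^-distribˡ-+-* t k ℓ)) ⟩
        t ^ (k + ℓ) * K₁                           ≤⟨ stopping-step n (t ^ (k + ℓ) * K₁) (K₂ * (a ^ k * c ^ ℓ)) (length X) (length Y) F W x>0 y>0 pot small ⟩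
        -- The blue factor is discarded by c ≤ t, so that `finish` does not depend on the remaining
        -- ℓ.
        K₂ * (a ^ k * c ^ ℓ) * w                   ≤⟨ *-monoˡ-≤ w (*-monoʳ-≤ K₂ (*-monoʳ-≤ (a ^ k) (^-mono-≤ ℓ c≤t))) ⟩
        K₂ * (a ^ k * t ^ ℓ) * w                   ≡⟨ e₂ K₂ (a ^ k) (t ^ ℓ) w ⟩
        t ^ ℓ * (K₂ * (a ^ k * w))                 ∎))
      where
      open ≤-Reasoning
      w = W ^ suc n * length Y
      e₁ : ∀ p q K → p * (q * K) ≡ q * p * K
      e₁ = solve-∀
      e₂ : ∀ K p q w → K * (p * q) * w ≡ q * (K * (p * w))
      e₂ = solve-∀
    ... | inj₁ K = inj₁ (clique-⊆ inj₂ K)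
    ... | inj₂ K = inj₂ (inj₂ K)

    Book≤ : ℕ → Set
    Book≤ N = ∀ k ℓ X Y F → length X ≤ N → k ≤ k₀ → Unique X → Unique Y → 0 < F →
      Excess X Y F → Potential k ℓ X Y F → Outcome k ℓ X Y

    -- A deficient vertex holds less than n/(n + 1) of the average share F/|X| of the excess.
    -- Deleting it leaves enough excess for `removal-step`.
    drop : ∀ N → Book≤ N → ∀ k ℓ {x₀} X₀ Y F (let X = x₀ ∷ X₀) → length X₀ ≤ N → suc k ≤ k₀ → Unique X → Unique Y → 0 < F →
      Excess X Y F → Potential (suc k) (suc ℓ) X Y F → ∀ w → w ∈ X →
      suc n * length X * (t * length (nbr R w Y)) < suc n * length X * (P * length Y) + n * F →
      Outcome (suc k) (suc ℓ) X Y
    drop N ih k ℓ {x₀} X₀ Y F len k≤ uX uY F>0 exc pot w w∈ deficient with remove (x₀ ∷ X₀) w∈ uX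
    ... | X′ , uX′ , sub , len′ , sums =
      outcome-⊆ {suc k} {suc ℓ} (λ z∈ → proj₁ (sub z∈))
        (ih (suc k) (suc ℓ) X′ Y F′ (subst (_≤ N) x′≡ len) k≤ uX′ uY F′>0 (∸-exact (t * e′) (P * (x′ * y)) F′>0)
          (removal-step n (t ^ (suc k + suc ℓ) * K₁) (K₂ * (a ^ suc k * c ^ suc ℓ)) (length X′) y F F′
            (subst (λ z → t ^ (suc k + suc ℓ) * K₁ * (suc z * y) ^ n ≤ K₂ * (a ^ suc k * c ^ suc ℓ) * F ^ suc n) x′≡ pot)
            increase))
      where
      open ≤-Reasoning
      x′≡ : length X₀ ≡ length X′
      x′≡ = suc-injective len′
      y = length Y
      x′ = length X′
      x = suc x′
      M = suc n
      e′ = edges G X′ Y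
      d = length (nbr R w Y)
      F′ = t * e′ ∸ P * (x′ * y)
      increase : (n * x′ + x) * F ≤ M * x * F′
      increase = ∸-excess (M * x) (P * (x′ * y)) (t * e′) _ (+-cancelʳ-≤ (M * x * (P * y) + n * F) _ _ (begin
        M * x * (P * (x′ * y)) + (n * x′ + x) * F + (M * x * (P * y) + n * F)  ≡⟨ e₁ n x′ P y F ⟩
        M * x * (P * (x * y) + F)                      ≡⟨ cong (M * x *_) (trans (cong (λ z → P * (z * y) + F) (sym len′)) (sym exc)) ⟩
        M * x * (t * edges G (x₀ ∷ X₀) Y)              ≡⟨ cong (λ z → M * x * (t * z)) (sums (λ x → length (nbr R x Y))) ⟩
        M * x * (t * (d + e′))                         ≡⟨ e₂ (M * x) t d e′ ⟩
        M * x * (t * e′) + M * x * (t * d)             ≤⟨ +-monoʳ-≤ (M * x * (t * e′)) (<⇒≤ (subst (λ z → M * z * (t * d) < M * z * (P * y) + n * F) len′ deficient)) ⟩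
        M * x * (t * e′) + (M * x * (P * y) + n * F)   ∎))
        where
        e₁ : ∀ n x′ P y F → suc n * suc x′ * (P * (x′ * y)) + (n * x′ + suc x′) * F + (suc n * suc x′ * (P * y) + n * F) ≡
             suc n * suc x′ * (P * (suc x′ * y) + F)
        e₁ = solve-∀
        e₂ : ∀ m t d e → m * (t * (d + e)) ≡ m * (t * e) + m * (t * d)
        e₂ = solve-∀
      F′>0 : 0 < F′
      F′>0 = *-pos-right (M * x) (<-≤-trans (*-mono-≤ {1} {n * x′ + x} (≤-trans (s≤s z≤n) (m≤n+m x (n * x′))) F>0) increase)

    -- Regularity is a condition on each vertex of X, so the pages S inherit at least n/(n + 1) of
    -- the proportional excess (|S|/|X|) F. Y is unchanged, and the spine supplies q + 1 blue
    -- vertices.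
    book-case : ∀ N → Book≤ N → ∀ k ℓ X Y F → length X ≤ suc N → suc k ≤ k₀ → Unique X → Unique Y → 0 < F →
      Excess X Y F → Potential (suc k) (suc q + ℓ) X Y F →
      (∀ {w} → w ∈ X → suc n * length X * (P * length Y) + n * F ≤ suc n * length X * (t * length (nbr R w Y))) →
      ∀ U → (∀ {u} → u ∈ U → u ∈ X) →
      0 < length X → (bk : BlueBook G (suc q) U X) →
      length X * γ ^ suc q ≤ length (BlueBook.pages bk) * t ^ suc q →
      Outcome (suc k) (suc q + ℓ) X Y
    book-case N ih k ℓ X Y F ≤N k≤ uX uY F>0 exc pot regular U U⊆X x>0 bk large =
      result (ih (suc k) ℓ S Y F′ s≤N k≤ (pages-uni bk) uY F′>0 (∸-exact (t * e′) (P * (s * y)) F′>0)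
        (blue-book-step n (t ^ (suc k + ℓ) * K₁) (K₂ * (a ^ suc k * c ^ ℓ)) x y s F F′
          (t ^ suc q) (c ^ suc q) (γ ^ suc q) x>0 (^-pos (suc q) c>0) pot′ large increase book-cost))
      where
      open ≤-Reasoning
      open BlueBook
      x = length X
      y = length Y
      M = suc n
      S = pages bk
      s = length S
      e′ = edges G S Y
      F′ = t * e′ ∸ P * (s * y)
      s>0 : 0 < s
      s>0 = *-pos-left (t ^ suc q) (<-≤-trans (*-mono-≤ x>0 (^-pos (suc q) γ>0)) large)
      s≤N : s ≤ N
      s≤N with shorter⁺ bk
      ... | inj₂ (u , u∈ , s≤) = ≤-pred (≤-trans (≤-trans (s≤s s≤) (length-filter-< (B u) X (U⊆X u∈) (B-irrefl u))) ≤N)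
      increase : s * n * F ≤ M * x * F′
      increase = ∸-excess (M * x) (P * (s * y)) (t * e′) _ (begin
        M * x * (P * (s * y)) + s * n * F                ≡⟨ e₁ (M * x) P s y n F ⟩
        s * (M * x * (P * y) + n * F)                    ≡⟨ sym (∑-const S _) ⟩
        ∑ S (λ _ → M * x * (P * y) + n * F)              ≤⟨ ∑-mono S (λ w∈ → regular (pages-⊆ bk w∈)) ⟩
        ∑ S (λ w → M * x * (t * length (nbr R w Y)))     ≡⟨ ∑-* S (M * x) _ ⟩
        M * x * ∑ S (λ w → t * length (nbr R w Y))       ≡⟨ cong (M * x *_) (∑-* S t _) ⟩
        M * x * (t * e′)                                 ∎)
        where
        e₁ : ∀ m P s y n F → m * (P * (s * y)) + s * n * F ≡ s * (m * (P * y) + n * F)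
        e₁ = solve-∀
      F′>0 : 0 < F′
      F′>0 = *-pos-right (M * x) (<-≤-trans (*-mono-≤ (*-mono-≤ s>0 n>0) F>0) increase)
      pot′ : t ^ (suc k + ℓ) * K₁ * t ^ suc q * (x * y) ^ n ≤ K₂ * (a ^ suc k * c ^ ℓ) * c ^ suc q * F ^ suc n
      pot′ = begin
        t ^ (suc k + ℓ) * K₁ * t ^ suc q * (x * y) ^ n       ≡⟨ cong (λ z → z * K₁ * t ^ suc q * (x * y) ^ n) (^-distribˡ-+-* t (suc k) ℓ) ⟩
        t ^ suc k * t ^ ℓ * K₁ * t ^ suc q * (x * y) ^ n     ≡⟨ e₁ (t ^ suc k) (t ^ ℓ) K₁ (t ^ suc q) ((x * y) ^ n) ⟩
        t ^ suc k * (t ^ suc q * t ^ ℓ) * K₁ * (x * y) ^ n   ≡⟨ cong (λ z → t ^ suc k * z * K₁ * (x * y) ^ n) (sym (^-distribˡ-+-* t (suc q) ℓ)) ⟩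
        t ^ suc k * t ^ (suc q + ℓ) * K₁ * (x * y) ^ n       ≡⟨ cong (λ z → z * K₁ * (x * y) ^ n) (sym (^-distribˡ-+-* t (suc k) (suc q + ℓ))) ⟩
        t ^ (suc k + (suc q + ℓ)) * K₁ * (x * y) ^ n         ≤⟨ pot ⟩
        K₂ * (a ^ suc k * c ^ (suc q + ℓ)) * F ^ M           ≡⟨ cong (λ z → K₂ * (a ^ suc k * z) * F ^ M) (^-distribˡ-+-* c (suc q) ℓ) ⟩
        K₂ * (a ^ suc k * (c ^ suc q * c ^ ℓ)) * F ^ M       ≡⟨ e₂ K₂ (a ^ suc k) (c ^ suc q) (c ^ ℓ) (F ^ M) ⟩
        K₂ * (a ^ suc k * c ^ ℓ) * c ^ suc q * F ^ M         ∎
        where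
        e₁ : ∀ p r K s u → p * r * K * s * u ≡ p * (s * r) * K * u
        e₁ = solve-∀
        e₂ : ∀ K p r s u → K * (p * (r * s)) * u ≡ K * (p * s) * r * u
        e₂ = solve-∀
      result : Outcome (suc k) ℓ S Y → Outcome (suc k) (suc q + ℓ) X Y
      result (inj₁ K) = inj₁ (clique-⊆ (λ { (inj₁ w∈) → inj₁ (pages-⊆ bk w∈) ; (inj₂ w∈) → inj₂ w∈ }) K)
      result (inj₂ (inj₁ K)) = inj₂ (inj₁ (clique-⊆ (λ { (inj₁ w∈) → U⊆X w∈ ; (inj₂ w∈) → w∈ }) (extend bk K)))
      result (inj₂ (inj₂ K)) = inj₂ (inj₂ K)

    -- If the red or the blue neighbourhood of v pays for its factor a/t or c/t, the induction
    -- continues there. If neither does, both tangent bounds hold, against `no-step-fails`.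
    step-at : ∀ N → Book≤ N → ∀ k ℓ X Y F → length X ≤ suc N → suc k ≤ k₀ → Unique X → Unique Y → 0 < F →
      Excess X Y F → Potential (suc k) (suc ℓ) X Y F → W * length Y ≤ F →
      (∀ {w} → w ∈ X → suc n * length X * (P * length Y) + n * F ≤ suc n * length X * (t * length (nbr R w Y))) →
      ∀ v → v ∈ X → (t * length (nbr B v X) ≤ᵇ suc γ * length X) ≡ true →
      E * (t * edges G X Y) * length (nbr R v Y) ≤
        E * t * length Y * edges G X (nbr R v Y) + F * length (nbr R v Y) →
      Outcome (suc k) (suc ℓ) X Y
    step-at N ih k ℓ X Y F ≤N k≤ uX uY F>0 exc pot large regular v v∈ low good = decide
      where
      open ≤-Reasoning
      x = length X
      y = length Y
      M = suc n
      Xᵣ = nbr R v X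
      Xᵦ = nbr B v X
      Yᵥ = nbr R v Y
      r = length Xᵣ
      b = length Xᵦ
      z = length Yᵥ
      Fᵣ = t * edges G Xᵣ Yᵥ ∸ P * (r * z)
      Fᵦ = t * edges G Xᵦ Yᵥ ∸ P * (b * z)
      xy>0 : 0 < x * y
      xy>0 = excess-pos {X} {Y} F>0 exc
      x>0 : 0 < x
      x>0 = *-pos-left y xy>0
      y>0 : 0 < y
      y>0 = *-pos-right x xy>0
      degree : P * y ≤ t * z
      degree = *-cancel-≤ (M * x) (*-mono-≤ {1} {M} (s≤s z≤n) x>0) (≤-trans (m≤m+n _ (n * F)) (regular v∈))
      z>0 : 0 < z
      z>0 = *-pos-right t (<-≤-trans (*-mono-≤ P>0 y>0) degree)
      few-blue : t * b ≤ suc γ * x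
      few-blue = ≤ᵇ⇒≤ (t * b) (suc γ * x) (subst IsTrue (sym low) tt)
      split : t * edges G X Yᵥ ≤ P * (x * z) + Fᵣ + Fᵦ + t * z
      split = begin
        t * edges G X Yᵥ
          ≤⟨ *-monoʳ-≤ t (split-≤ G v X uX (λ w → length (nbr R w Yᵥ))) ⟩
        t * (length (nbr R v Yᵥ) + (edges G Xᵣ Yᵥ + edges G Xᵦ Yᵥ))
          ≤⟨ *-monoʳ-≤ t (+-monoˡ-≤ _ (length-filter-≤ (R v) Yᵥ)) ⟩
        t * (z + (edges G Xᵣ Yᵥ + edges G Xᵦ Yᵥ))
          ≡⟨ e₁ t z (edges G Xᵣ Yᵥ) (edges G Xᵦ Yᵥ) ⟩
        t * edges G Xᵣ Yᵥ + t * edges G Xᵦ Yᵥ + t * z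
          ≤⟨ +-monoˡ-≤ (t * z) (+-mono-≤ (m≤n+m∸n _ (P * (r * z))) (m≤n+m∸n _ (P * (b * z)))) ⟩
        P * (r * z) + Fᵣ + (P * (b * z) + Fᵦ) + t * z
          ≡⟨ e₂ P r b z Fᵣ Fᵦ (t * z) ⟩
        P * ((r + b) * z) + Fᵣ + Fᵦ + t * z
          ≤⟨ +-monoˡ-≤ (t * z) (+-monoˡ-≤ Fᵦ (+-monoˡ-≤ Fᵣ (*-monoʳ-≤ P (*-monoˡ-≤ z (degrees-≤ G v X))))) ⟩
        P * (x * z) + Fᵣ + Fᵦ + t * z ∎
        where
        e₁ : ∀ t z a b → t * (z + (a + b)) ≡ t * a + t * b + t * z
        e₁ = solve-∀
        e₂ : ∀ P r b z f g u → P * (r * z) + f + (P * (b * z) + g) + u ≡ P * ((r + b) * z) + f + g + u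
        e₂ = solve-∀
      Ety≤F : E * t * y ≤ F
      Ety≤F = begin
        E * t * y                   ≡⟨ e₁ (E * t * y) ⟩
        E * t * y * 1               ≤⟨ *-monoʳ-≤ (E * t * y) (*-mono-≤ {1} {2 * t} (≤-trans t>0 (m≤n*m t 2)) h>0) ⟩
        E * t * y * (2 * t * h)     ≡⟨ e₂ E t y h ⟩
        W * y                       ≤⟨ large ⟩
        F                           ∎
        where
        e₁ : ∀ a → a ≡ a * 1
        e₁ = solve-∀
        e₂ : ∀ E t y h → E * t * y * (2 * t * h) ≡ 2 * E * (t * t) * h * y
        e₂ = solve-∀
      smaller : ∀ (S : List V) → length S < x → length S ≤ N
      smaller S S<x = ≤-pred (≤-trans S<x ≤N)
      -- The comparison of potentials is strict so that it also yields a positive new excess.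
      positive : ∀ a r F′ → a * F ^ M * (r * z) ^ n < t * F′ ^ M * (x * y) ^ n → 0 < F′
      positive a r zero    h = ⊥-elim (<⇒≱ h (≤-trans (≤-reflexive (cong (_* (x * y) ^ n) (*-zeroʳ t))) z≤n))
      positive a r (suc _) h = s≤s z≤n
      red-pot : t * (t ^ (k + suc ℓ) * K₁) * (x * y) ^ n ≤ K₂ * (a ^ k * c ^ suc ℓ) * a * F ^ M
      red-pot = begin
        t * (t ^ (k + suc ℓ) * K₁) * (x * y) ^ n        ≡⟨ cong (_* (x * y) ^ n) (sym (*-assoc t _ K₁)) ⟩
        t ^ (suc k + suc ℓ) * K₁ * (x * y) ^ n          ≤⟨ pot ⟩
        K₂ * (a ^ suc k * c ^ suc ℓ) * F ^ M            ≡⟨ e₁ K₂ a (a ^ k) (c ^ suc ℓ) (F ^ M) ⟩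
        K₂ * (a ^ k * c ^ suc ℓ) * a * F ^ M            ∎
        where
        e₁ : ∀ K a p q f → K * ((a * p) * q) * f ≡ K * (p * q) * a * f
        e₁ = solve-∀
      blue-pot : t * (t ^ (suc k + ℓ) * K₁) * (x * y) ^ n ≤ K₂ * (a ^ suc k * c ^ ℓ) * c * F ^ M
      blue-pot = begin
        t * (t ^ (suc k + ℓ) * K₁) * (x * y) ^ n        ≡⟨ cong (_* (x * y) ^ n) (sym (*-assoc t _ K₁)) ⟩
        t ^ suc (suc k + ℓ) * K₁ * (x * y) ^ n          ≡⟨ cong (λ j → t ^ j * K₁ * (x * y) ^ n) (sym (+-suc (suc k) ℓ)) ⟩
        t ^ (suc k + suc ℓ) * K₁ * (x * y) ^ n          ≤⟨ pot ⟩
        K₂ * (a ^ suc k * c ^ suc ℓ) * F ^ M            ≡⟨ e₁ K₂ (a ^ suc k) c (c ^ ℓ) (F ^ M) ⟩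
        K₂ * (a ^ suc k * c ^ ℓ) * c * F ^ M            ∎
        where
        e₁ : ∀ K p c q f → K * (p * (c * q)) * f ≡ K * (p * q) * c * f
        e₁ = solve-∀
      decide : Outcome (suc k) (suc ℓ) X Y
      decide with a * F ^ M * (r * z) ^ n <? t * Fᵣ ^ M * (x * y) ^ n
                | c * F ^ M * (b * z) ^ n <? t * Fᵦ ^ M * (x * y) ^ n
      ... | yes red | _ = result (ih k (suc ℓ) Xᵣ Yᵥ Fᵣ
              (smaller Xᵣ (length-filter-< (R v) X v∈ (R-irrefl v))) (<⇒≤ k≤)
              (Unique-filterᵇ _ X uX) (Unique-filterᵇ _ Y uY) Fᵣ>0
              (∸-exact (t * edges G Xᵣ Yᵥ) (P * (r * z)) Fᵣ>0)
              (vertex-step n (t ^ (k + suc ℓ) * K₁) (K₂ * (a ^ k * c ^ suc ℓ)) t a x y r z F Fᵣ a>0 F>0 red-pot (<⇒≤ red)))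
        where
        Fᵣ>0 : 0 < Fᵣ
        Fᵣ>0 = positive a r Fᵣ red
        extend-red : ∀ {w} → w ∈ Xᵣ ⊎ w ∈ Yᵥ → (w ∈ X ⊎ w ∈ Y) × R v w ≡ true
        extend-red (inj₁ w∈) = let p , e = ∈-filterᵇ (R v) X w∈ in inj₁ p , e
        extend-red (inj₂ w∈) = let p , e = ∈-filterᵇ (R v) Y w∈ in inj₂ p , e
        result : Outcome k (suc ℓ) Xᵣ Yᵥ → Outcome (suc k) (suc ℓ) X Y
        result (inj₁ K) = inj₁ (clique-∷ v (inj₁ v∈) extend-red K)
        result (inj₂ (inj₁ K)) = inj₂ (inj₁ (clique-⊆ (λ w∈ → proj₁ (∈-filterᵇ (R v) X w∈)) K))
        result (inj₂ (inj₂ K)) = inj₂ (inj₂ (clique-⊆ (λ w∈ → proj₁ (∈-filterᵇ (R v) Y w∈)) K))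
      ... | no _ | yes blue = result (ih (suc k) ℓ Xᵦ Yᵥ Fᵦ
              (smaller Xᵦ (length-filter-< (B v) X v∈ (B-irrefl v))) k≤
              (Unique-filterᵇ _ X uX) (Unique-filterᵇ _ Y uY) Fᵦ>0
              (∸-exact (t * edges G Xᵦ Yᵥ) (P * (b * z)) Fᵦ>0)
              (vertex-step n (t ^ (suc k + ℓ) * K₁) (K₂ * (a ^ suc k * c ^ ℓ)) t c x y b z F Fᵦ c>0 F>0 blue-pot (<⇒≤ blue)))
        where
        Fᵦ>0 : 0 < Fᵦ
        Fᵦ>0 = positive c b Fᵦ blue
        result : Outcome (suc k) ℓ Xᵦ Yᵥ → Outcome (suc k) (suc ℓ) X Y
        result (inj₁ K) = inj₁ (clique-⊆ (λ { (inj₁ w∈) → inj₁ (proj₁ (∈-filterᵇ (B v) X w∈))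
                                             ; (inj₂ w∈) → inj₂ (proj₁ (∈-filterᵇ (R v) Y w∈)) }) K)
        result (inj₂ (inj₁ K)) = inj₂ (inj₁ (clique-∷ v v∈ (∈-filterᵇ (B v) X) K))
        result (inj₂ (inj₂ K)) = inj₂ (inj₂ (clique-⊆ (λ w∈ → proj₁ (∈-filterᵇ (R v) Y w∈)) K))
      ... | no ¬red | no ¬blue = ⊥-elim (no-step-fails n t (suc γ) β′ A Δ E x y r b z F Fᵣ Fᵦ β-sum slack
              x>0 z>0 F>0 (degrees-≤ G v X) few-blue
              (tangent-bound n t P a β′ A E x y r z F Fᵣ t>0 P>0 (≮⇒≥ ¬red) degree red-cost)
              (tangent-bound n t P c (suc γ) (A + Δ) E x y b z F Fᵦ t>0 P>0 (≮⇒≥ ¬blue) degree blue-cost)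
              (excess-split t P E x y z (edges G X Y) (edges G X Yᵥ) F Fᵣ Fᵦ exc good split Ety≤F))

    vertex-case : ∀ N → Book≤ N → ∀ k ℓ X Y F → length X ≤ suc N → suc k ≤ k₀ → Unique X → Unique Y → 0 < F →
      Excess X Y F → Potential (suc k) (suc ℓ) X Y F → W * length Y ≤ F →
      (∀ {w} → w ∈ X → suc n * length X * (P * length Y) + n * F ≤ suc n * length X * (t * length (nbr R w Y))) →
      length (filterᵇ (λ v → not (t * length (nbr B v X) ≤ᵇ suc γ * length X)) X) ≤ h →
      Outcome (suc k) (suc ℓ) X Y
    vertex-case N ih k ℓ X Y F ≤N k≤ uX uY F>0 exc pot large regular few =
      let v , v∈ , low , good = good-vertex G t P E h F X Y (λ v → t * length (nbr B v X) ≤ᵇ suc γ * length X)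
             t>0 P>0 E>0 h>0 x>0 y>0 exc degree few large
      in step-at N ih k ℓ X Y F ≤N k≤ uX uY F>0 exc pot large regular v v∈ low good
      where
      xy>0 : 0 < length X * length Y
      xy>0 = excess-pos {X} {Y} F>0 exc
      x>0 : 0 < length X
      x>0 = *-pos-left (length Y) xy>0
      y>0 : 0 < length Y
      y>0 = *-pos-right (length X) xy>0
      degree : ∀ {v} → v ∈ X → P * length Y ≤ t * length (nbr R v Y)
      degree v∈ = *-cancel-≤ (suc n * length X) (*-mono-≤ {1} {suc n} (s≤s z≤n) x>0)
        (≤-trans (m≤m+n _ (n * F)) (regular v∈))

    -- At most h vertices of high blue degree can be tolerated by `good-vertex`; h or more contain a
    -- red clique of the original size k₀, which is enough, or a blue clique from which to build a
    -- book.
    regular-case : ∀ N → Book≤ N → ∀ k ℓ X Y F → length X ≤ suc N → suc k ≤ k₀ → Unique X → Unique Y → 0 < F →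
      Excess X Y F → Potential (suc k) (suc ℓ) X Y F → W * length Y ≤ F →
      (∀ {w} → w ∈ X → suc n * length X * (P * length Y) + n * F ≤ suc n * length X * (t * length (nbr R w Y))) →
      Outcome (suc k) (suc ℓ) X Y
    regular-case N ih k ℓ X Y F ≤N k≤ uX uY F>0 exc pot large regular
      with h ≤? length H
      where
      low : V → Bool
      low v = t * length (nbr B v X) ≤ᵇ suc γ * length X
      H = filterᵇ (not ∘ low) X
    ... | no few = vertex-case N ih k ℓ X Y F ≤N k≤ uX uY F>0 exc pot large regular (<⇒≤ (≰⇒> few))
    ... | yes many with ramsey (filterᵇ _ X) (Unique-filterᵇ _ X uX) many
    ...   | inj₁ K = inj₁ (clique-⊆ (λ v∈ → inj₁ (proj₁ (∈-filterᵇ _ X v∈))) (clique-≤ k≤ K))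
    ...   | inj₂ K@(U , lenU , blue , U⊆) with suc ℓ ≤? suc q
    -- If at most q + 1 blue vertices are still wanted, the blue clique of size t (q + 1) has them
    -- already; otherwise a full spine fits.
    ...     | yes ℓ≤q = inj₂ (inj₁ (clique-⊆ (λ v∈ → proj₁ (∈-filterᵇ _ X v∈))
                (clique-≤ (≤-trans ℓ≤q (≤-trans (≤-reflexive (sym (*-identityˡ _))) (*-monoˡ-≤ (suc q) t>0))) K)))
    ...     | no ℓ≰q with m≤n⇒∃[o]m+o≡n (<⇒≤ (≰⇒> ℓ≰q))
    ...       | ℓ′ , refl = let bk , large = dense-blue-book G q t γ U X t>0 γ>0 (blue-unique blue) (blue-all U blue) lenU uX x>0
                                    (λ u∈ → not-low _ (proj₂ (∈-filterᵇ _ X (U⊆ u∈))))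
                  in book-case N ih k ℓ′ X Y F ≤N k≤ uX uY F>0 exc pot regular U
                       (λ u∈ → proj₁ (∈-filterᵇ _ X (U⊆ u∈))) x>0 bk large
      where
      x>0 : 0 < length X
      x>0 = *-pos-left (length Y) (excess-pos {X} {Y} F>0 exc)
      not-low : ∀ v → not (t * length (nbr B v X) ≤ᵇ suc γ * length X) ≡ true → suc γ * length X ≤ t * length (nbr B v X)
      not-low v eq with t * length (nbr B v X) ≤? suc γ * length X
      ... | no ≰ = <⇒≤ (≰⇒> ≰)
      ... | yes p with t * length (nbr B v X) ≤ᵇ suc γ * length X | ≤⇒≤ᵇ p
      not-low v () | yes p | true | _

    -- Induction on a bound for |X|, since deletion, book and vertex steps all make X smaller. Small
    -- excess is tested first, then deficient vertices; what remains is regular with large excess.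
    book : ∀ N → Book≤ N
    book N zero    ℓ    X Y F _ _ _ _ _ _ _ = inj₁ clique-∅
    book N (suc k) zero X Y F _ _ _ _ _ _ _ = inj₂ (inj₁ clique-∅)
    book N (suc k) (suc ℓ) [] Y F _ _ _ _ F>0 exc _ =
      ⊥-elim (<-irrefl (sym (trans (sym (cong (_+ F) (*-zeroʳ P))) (trans (sym exc) (*-zeroʳ t)))) F>0)
    book (suc N) (suc k) (suc ℓ) X@(_ ∷ X₀) Y F ≤N@(s≤s len) k≤ uX uY F>0 exc pot
      with F ≤? W * length Y
    ... | yes small = stop (suc k) (suc ℓ) X Y F k≤ uY (s≤s z≤n) y>0 pot small
      where
      y>0 : 0 < length Y
      y>0 = *-pos-right W (<-≤-trans F>0 small)
    ... | no large
      with search-< X (λ w → suc n * length X * (t * length (nbr R w Y)))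
                      (λ w → suc n * length X * (P * length Y) + n * F)
    ...   | inj₁ (w , w∈ , deficient) = drop N (book N) k ℓ X₀ Y F len k≤ uX uY F>0 exc pot w w∈ deficient
    ...   | inj₂ regular = regular-case N (book N) k ℓ X Y F ≤N k≤ uX uY F>0 exc pot (<⇒≤ (≰⇒> large)) regular

  -- Improving a linear bound

  ^-*-distrib-^ : ∀ a b k ℓ d → (a ^ k * b ^ ℓ) ^ d ≡ (a ^ d) ^ k * b ^ (ℓ * d)
  ^-*-distrib-^ a b k ℓ d = trans (^-distrib-* (a ^ k) (b ^ ℓ) d) (cong₂ _*_ (^-comm a k d) (^-*-assoc b ℓ d))

  power-split : ∀ a b k d m → (a ^ d * b ^ m) ^ k ≡ (a ^ d) ^ k * b ^ (m * k)
  power-split a b k d m = trans (^-distrib-* (a ^ d) (b ^ m) k) (cong ((a ^ d) ^ k *_) (^-*-assoc b m k))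

  -- The quotient (a₁/a)^k (b₁/b)^ℓ grows as ℓ decreases because b₁ ≤ b, so it suffices to compare
  -- at ℓ/k = m/(d + 1). The j missing factors b are supplied after raising to the power d + 1.
  below-crossing : ∀ a b a₁ b₁ d m k ℓ → 0 < b → b₁ ≤ b →
    a ^ suc d * b ^ m ≤ a₁ ^ suc d * b₁ ^ m → ℓ * suc d ≤ m * k → a ^ k * b ^ ℓ ≤ a₁ ^ k * b₁ ^ ℓ
  below-crossing a b a₁ b₁ d m k ℓ b>0 b₁≤b cross le with m≤n⇒∃[o]m+o≡n le
  ... | j , eq = ^-cancel-≤ d (*-cancel-≤ (b ^ j) (^-pos j b>0) (begin
    b ^ j * (a ^ k * b ^ ℓ) ^ suc d                     ≡⟨ cong (b ^ j *_) (^-*-distrib-^ a b k ℓ (suc d)) ⟩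
    b ^ j * ((a ^ suc d) ^ k * b ^ (ℓ * suc d))         ≡⟨ join a b ⟩
    (a ^ suc d * b ^ m) ^ k                             ≤⟨ ^-mono-≤ k cross ⟩
    (a₁ ^ suc d * b₁ ^ m) ^ k                           ≡⟨ sym (join a₁ b₁) ⟩
    b₁ ^ j * ((a₁ ^ suc d) ^ k * b₁ ^ (ℓ * suc d))      ≤⟨ *-monoˡ-≤ _ (^-mono-≤ j b₁≤b) ⟩
    b ^ j * ((a₁ ^ suc d) ^ k * b₁ ^ (ℓ * suc d))       ≡⟨ cong (b ^ j *_) (sym (^-*-distrib-^ a₁ b₁ k ℓ (suc d))) ⟩
    b ^ j * (a₁ ^ k * b₁ ^ ℓ) ^ suc d                   ∎))
    where
    open ≤-Reasoning
    shuffle : ∀ p q r → p * (q * r) ≡ q * (r * p)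
    shuffle = solve-∀
    join : ∀ a b → b ^ j * ((a ^ suc d) ^ k * b ^ (ℓ * suc d)) ≡ (a ^ suc d * b ^ m) ^ k
    join a b = trans (shuffle (b ^ j) ((a ^ suc d) ^ k) (b ^ (ℓ * suc d)))
      (trans (cong ((a ^ suc d) ^ k *_) (trans (sym (^-distribˡ-+-* b (ℓ * suc d) j)) (cong (b ^_) eq)))
             (sym (power-split a b k (suc d) m)))

  -- On this side of the ratio m/(d + 1) there are j surplus factors, and v₁ ≤ v₂ makes them
  -- favourable.
  above-crossing : ∀ u₁ v₁ u₂ v₂ d m k ℓ → v₁ ≤ v₂ →
    u₁ ^ suc d * v₁ ^ m ≤ u₂ ^ suc d * v₂ ^ m → m * k ≤ ℓ * suc d → u₁ ^ k * v₁ ^ ℓ ≤ u₂ ^ k * v₂ ^ ℓ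
  above-crossing u₁ v₁ u₂ v₂ d m k ℓ v₁≤v₂ cross le with m≤n⇒∃[o]m+o≡n le
  ... | j , eq = ^-cancel-≤ d (begin
    (u₁ ^ k * v₁ ^ ℓ) ^ suc d                 ≡⟨ split u₁ v₁ ⟩
    (u₁ ^ suc d * v₁ ^ m) ^ k * v₁ ^ j        ≤⟨ *-mono-≤ (^-mono-≤ k cross) (^-mono-≤ j v₁≤v₂) ⟩
    (u₂ ^ suc d * v₂ ^ m) ^ k * v₂ ^ j        ≡⟨ sym (split u₂ v₂) ⟩
    (u₂ ^ k * v₂ ^ ℓ) ^ suc d                 ∎)
    where
    open ≤-Reasoning
    split : ∀ u v → (u ^ k * v ^ ℓ) ^ suc d ≡ (u ^ suc d * v ^ m) ^ k * v ^ j
    split u v = trans (^-*-distrib-^ u v k ℓ (suc d)) (trans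
      (cong ((u ^ suc d) ^ k *_) (trans (cong (v ^_) (sym eq)) (^-distribˡ-+-* v (m * k) j)))
      (trans (sym (*-assoc ((u ^ suc d) ^ k) _ _)) (cong (_* v ^ j) (sym (power-split u v k (suc d) m)))))

  ceiling : ∀ m d → 0 < d → d ≤ m → ∃ λ h → 0 < h × m ≤ h * d × h * d ≤ 2 * m
  ceiling m d d>0 d≤m = suc (m / d) , s≤s z≤n , lower , upper
    where
    instance
      d≢0 : NonZero d
      d≢0 = >-nonZero d>0
    lower : m ≤ suc (m / d) * d
    lower = ≤-trans (≤-reflexive (m≡m%n+[m/n]*n m d)) (+-monoˡ-≤ _ (<⇒≤ (m%n<n m d)))
    upper : suc (m / d) * d ≤ 2 * m
    upper = ≤-trans (+-mono-≤ d≤m (m/n*n≤m m d)) (≤-reflexive (cong (m +_) (sym (+-identityʳ m))))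

  -- The line (a₁/t, b₁/t) is improved to (a/t, b/t), the two crossing at ℓ/k = num/(den + 1).
  -- The exceptional set of high blue degrees costs a factor (1 + 1/s)^k; of the 2 units between 1 - b/t and P/t
  -- one is the initial excess, the other pays for the vertex whose blue neighbourhood is taken.
  record Step (t a₁ b₁ a b : ℕ) : Set where
    field
      P β′ γ A Δ E n a′ y′ c q s num den : ℕ
      P>0 : 0 < P
      γ>0 : 0 < γ
      E>0 : 0 < E
      n>0 : 0 < n
      s>0 : 0 < s
      b>0 : 0 < b
      a′>0 : 0 < a′
      y′>0 : 0 < y′
      c>0 : 0 < c
      a≤t : a ≤ t
      c≤t : c ≤ t
      b₁≤b : b₁ ≤ b
      densities : b + 2 + P ≡ t
      es-line : a′ + y′ ≡ t
      β-sum : suc γ + β′ ≡ t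
      red-cost : a′ * (t * E ^ suc n) ≤ P * β′ * A ^ suc n
      blue-cost : c * (t * E ^ suc n) ≤ P * suc γ * (A + Δ) ^ suc n
      book-cost : c ^ suc q * suc n ^ suc n ≤ γ ^ suc q * n ^ suc n
      slack : A * t + Δ * suc γ + 2 * t < E * t
      old-crossing : a ^ suc den * b ^ num ≤ a₁ ^ suc den * b₁ ^ num
      book-slope : b * b ≤ c * y′
      book-crossing : ((s + 1) ^ suc n * (a * a)) ^ suc den * (b * b) ^ num ≤
                      (a′ * t * s ^ suc n) ^ suc den * (c * y′) ^ num

  module Improve {t a₁ b₁ a b : ℕ} (𝒮 : Step t a₁ b₁ a b) where
    open Step 𝒮

    t>0 : 0 < t
    t>0 = subst (0 <_) densities (≤-trans b>0 (≤-trans (m≤m+n b 2) (m≤m+n (b + 2) P)))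

    b≤t : b ≤ t
    b≤t = subst (b ≤_) densities (≤-trans (m≤m+n b 2) (m≤m+n (b + 2) P))

    -- u is the size of the blue clique that a book starts from. Since h is at most 2 (s + 1)^u (1 +
    -- 1/s)^k, g is the part of the bound on W^(n + 1) that does not depend on k.
    u g : ℕ
    u = t * suc q
    g = (2 * E * (t * t) * (2 * (s + 1) ^ u)) ^ suc n

    constant-≤ : ∀ C k ℓ N → C * t ^ (k + ℓ) ≤ N * (a ^ k * b ^ ℓ) → C ≤ N
    constant-≤ C k ℓ N large = *-cancel-≤ (t ^ (k + ℓ)) (^-pos (k + ℓ) t>0) (begin
      t ^ (k + ℓ) * C          ≡⟨ *-comm _ C ⟩
      C * t ^ (k + ℓ)          ≤⟨ large ⟩
      N * (a ^ k * b ^ ℓ)      ≤⟨ *-monoʳ-≤ N (*-mono-≤ (^-mono-≤ k a≤t) (^-mono-≤ ℓ b≤t)) ⟩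
      N * (t ^ k * t ^ ℓ)      ≡⟨ cong (N *_) (sym (^-distribˡ-+-* t k ℓ)) ⟩
      N * t ^ (k + ℓ)          ≡⟨ *-comm N _ ⟩
      t ^ (k + ℓ) * N          ∎)
      where open ≤-Reasoning

    module _ {V : Set} (G : Graph V) where
      open Graph G

      -- At the start X = Y and F ≥ N², so the potential is at least N², and the squared size
      -- hypothesis bounds N² from below. `book-crossing` compares this with all costs at the
      -- crossing ratio, and `book-slope` extends the comparison to larger ℓ/k.
      initial-potential : ∀ k ℓ N h → g * t ^ (k + ℓ) * t ^ (k + ℓ) ≤ N * N * ((a * a) ^ k * (b * b) ^ ℓ) →
        num * k ≤ ℓ * suc den → h * s ^ k ≤ 2 * (s + 1) ^ (k + u) →
        t ^ (k + ℓ) * (t ^ ℓ * (2 * E * (t * t) * h) ^ suc n) ≤ y′ ^ ℓ * (a′ ^ k * c ^ ℓ) * (N * N)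
      initial-potential k ℓ N h large ratio h≤ =
        *-cancel-≤ ((s ^ k) ^ M * t ^ k) (*-mono-≤ (^-pos M (^-pos k s>0)) (^-pos k t>0)) (begin
          (s ^ k) ^ M * t ^ k * (t ^ (k + ℓ) * (t ^ ℓ * W ^ M))
            ≡⟨ e₁ ((s ^ k) ^ M) (t ^ k) (t ^ (k + ℓ)) (t ^ ℓ) (W ^ M) ⟩
          t ^ (k + ℓ) * (t ^ k * t ^ ℓ) * (W ^ M * (s ^ k) ^ M)
            ≡⟨ cong₂ (λ z w → t ^ (k + ℓ) * z * w) (sym (^-distribˡ-+-* t k ℓ)) (sym (^-distrib-* W (s ^ k) M)) ⟩
          t ^ (k + ℓ) * t ^ (k + ℓ) * (W * s ^ k) ^ M
            ≤⟨ *-monoʳ-≤ (t ^ (k + ℓ) * t ^ (k + ℓ)) (^-mono-≤ M Ws≤) ⟩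
          t ^ (k + ℓ) * t ^ (k + ℓ) * (g₀ * (s + 1) ^ k) ^ M
            ≡⟨ cong (t ^ (k + ℓ) * t ^ (k + ℓ) *_) (^-distrib-* g₀ ((s + 1) ^ k) M) ⟩
          t ^ (k + ℓ) * t ^ (k + ℓ) * (g * ((s + 1) ^ k) ^ M)
            ≡⟨ e₂ (t ^ (k + ℓ)) g (((s + 1) ^ k) ^ M) ⟩
          g * t ^ (k + ℓ) * t ^ (k + ℓ) * ((s + 1) ^ k) ^ M
            ≤⟨ *-monoˡ-≤ (((s + 1) ^ k) ^ M) large ⟩
          N * N * ((a * a) ^ k * (b * b) ^ ℓ) * ((s + 1) ^ k) ^ M
            ≡⟨ e₃ (N * N) ((a * a) ^ k) ((b * b) ^ ℓ) (((s + 1) ^ k) ^ M) ⟩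
          N * N * (((s + 1) ^ k) ^ M * (a * a) ^ k * (b * b) ^ ℓ)
            ≡⟨ cong (λ z → N * N * (z * (b * b) ^ ℓ)) (trans (cong (_* (a * a) ^ k) (^-comm (s + 1) k M))
                 (sym (^-distrib-* ((s + 1) ^ M) (a * a) k))) ⟩
          N * N * (((s + 1) ^ M * (a * a)) ^ k * (b * b) ^ ℓ)
            ≤⟨ *-monoʳ-≤ (N * N) (above-crossing ((s + 1) ^ M * (a * a)) (b * b) (a′ * t * s ^ M) (c * y′)
                 den num k ℓ book-slope book-crossing ratio) ⟩
          N * N * ((a′ * t * s ^ M) ^ k * (c * y′) ^ ℓ)
            ≡⟨ cong₂ (λ z w → N * N * (z * w))
                 (trans (^-distrib-* (a′ * t) (s ^ M) k) (cong₂ _*_ (^-distrib-* a′ t k) (^-comm s M k)))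
                 (^-distrib-* c y′ ℓ) ⟩
          N * N * (a′ ^ k * t ^ k * (s ^ k) ^ M * (c ^ ℓ * y′ ^ ℓ))
            ≡⟨ e₄ (N * N) (a′ ^ k) (t ^ k) ((s ^ k) ^ M) (c ^ ℓ) (y′ ^ ℓ) ⟩
          (s ^ k) ^ M * t ^ k * (y′ ^ ℓ * (a′ ^ k * c ^ ℓ) * (N * N)) ∎)
        where
        open ≤-Reasoning
        M = suc n
        W = 2 * E * (t * t) * h
        g₀ = 2 * E * (t * t) * (2 * (s + 1) ^ u)
        Ws≤ : W * s ^ k ≤ g₀ * (s + 1) ^ k
        Ws≤ = begin
          W * s ^ k                                          ≡⟨ *-assoc (2 * E * (t * t)) h (s ^ k) ⟩
          2 * E * (t * t) * (h * s ^ k)                      ≤⟨ *-monoʳ-≤ (2 * E * (t * t)) h≤ ⟩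
          2 * E * (t * t) * (2 * (s + 1) ^ (k + u))          ≡⟨ cong (λ z → 2 * E * (t * t) * (2 * z)) (^-distribˡ-+-* (s + 1) k u) ⟩
          2 * E * (t * t) * (2 * ((s + 1) ^ k * (s + 1) ^ u)) ≡⟨ e₀ (2 * E * (t * t)) ((s + 1) ^ k) ((s + 1) ^ u) ⟩
          g₀ * (s + 1) ^ k                                   ∎
          where
          e₀ : ∀ w p q → w * (2 * (p * q)) ≡ w * (2 * q) * p
          e₀ = solve-∀
        e₁ : ∀ s p T r w → s * p * (T * (r * w)) ≡ T * (p * r) * (w * s)
        e₁ = solve-∀
        e₂ : ∀ T g r → T * T * (g * r) ≡ g * T * T * r
        e₂ = solve-∀
        e₃ : ∀ N p q r → N * (p * q) * r ≡ N * (r * p * q)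
        e₃ = solve-∀
        e₄ : ∀ N p t s c y → N * (p * t * s * (c * y)) ≡ s * t * (y * (p * c) * N)
        e₄ = solve-∀

      dense : ∀ k ℓ Y → Unique Y → 0 < length Y → suc P * (length Y * length Y) ≤ t * edges G Y Y →
        g * t ^ (k + ℓ) * t ^ (k + ℓ) ≤ length Y * length Y * ((a * a) ^ k * (b * b) ^ ℓ) →
        num * k ≤ ℓ * suc den → Clique R k (_∈ Y) ⊎ Clique B ℓ (_∈ Y)
      dense k ℓ Y uY N>0 density large ratio = result
        where
        open ≤-Reasoning
        N = length Y
        s^k≤ : s ^ k ≤ (s + 1) ^ (k + u)
        s^k≤ = begin
          s ^ k                          ≡⟨ sym (*-identityʳ _) ⟩
          s ^ k * 1                      ≤⟨ *-mono-≤ (^-mono-≤ k (m≤m+n s 1)) (^-pos u (m≤n+m 1 s)) ⟩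
          (s + 1) ^ k * (s + 1) ^ u      ≡⟨ sym (^-distribˡ-+-* (s + 1) k u) ⟩
          (s + 1) ^ (k + u)              ∎
        -- Erdős-Szekeres with the pair (s/(s + 1), 1/(s + 1)): as u is fixed, a red k-clique or
        -- blue u-clique needs only a constant times (1 + 1/s)^k vertices.
        size : ∃ λ h → 0 < h × (s + 1) ^ (k + u) ≤ h * s ^ k × h * s ^ k ≤ 2 * (s + 1) ^ (k + u)
        size = ceiling ((s + 1) ^ (k + u)) (s ^ k) (^-pos k s>0) s^k≤
        F : ℕ
        F = t * edges G Y Y ∸ P * (N * N)
        -- The density is at least (P + 1)/t, one unit above the reference density P/t.
        F≥ : N * N ≤ F
        F≥ = subst (_≤ F) (m+n∸n≡m (N * N) (P * (N * N))) (∸-monoˡ-≤ (P * (N * N)) density)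
        F>0 : 0 < F
        F>0 = ≤-trans (*-mono-≤ N>0 N>0) F≥
        module _ (h : ℕ) (h>0 : 0 < h) (h≥ : (s + 1) ^ (k + u) ≤ h * s ^ k) (h≤ : h * s ^ k ≤ 2 * (s + 1) ^ (k + u)) where
          W′ = 2 * E * (t * t) * h
          W′>0 : 0 < W′
          W′>0 = *-mono-≤ (*-mono-≤ (*-mono-≤ {1} {2} (s≤s z≤n) E>0) (*-mono-≤ t>0 t>0)) h>0
          parameters : Parameters G
          parameters = record
            { t = t ; P = P ; β′ = β′ ; γ = γ ; A = A ; Δ = Δ ; E = E ; n = n ; a = a′ ; c = c ; q = q ; h = h
            -- Chosen so that the potential bound at the stop reads |Y| ≥ (t/a′)^k (t/y′)^ℓ for the
            -- current k, which is what Erdős-Szekeres needs in `finish`.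
            ; K₁ = t ^ ℓ * W′ ^ suc n ; K₂ = y′ ^ ℓ ; k₀ = k ; ℓ₀ = ℓ
            ; t>0 = t>0 ; P>0 = P>0 ; γ>0 = γ>0 ; E>0 = E>0 ; n>0 = n>0 ; a>0 = a′>0 ; c>0 = c>0 ; h>0 = h>0
            ; c≤t = c≤t ; β-sum = β-sum ; red-cost = red-cost ; blue-cost = blue-cost ; book-cost = book-cost ; slack = slack
            ; ramsey = λ H uH h≤H → erdős-szekeres G s 1 s>0 (s≤s z≤n) k u H uH (begin
                1 * (s + 1) ^ (k + u)        ≡⟨ *-identityˡ _ ⟩
                (s + 1) ^ (k + u)            ≤⟨ h≥ ⟩
                h * s ^ k                    ≤⟨ *-monoˡ-≤ (s ^ k) h≤H ⟩
                length H * s ^ k             ≡⟨ cong (length H *_) (sym (trans (cong (s ^ k *_) (^-zeroˡ u)) (*-identityʳ _))) ⟩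
                length H * (s ^ k * 1 ^ u)   ∎)
            ; finish = λ k′ Z _ uZ enough → erdős-szekeres G a′ y′ a′>0 y′>0 k′ ℓ Z uZ
                (subst (λ z → 1 * z ^ (k′ + ℓ) ≤ length Z * (a′ ^ k′ * y′ ^ ℓ)) (sym es-line)
                  (*-cancel-≤ (W′ ^ suc n) (^-pos (suc n) W′>0) (begin
                    W′ ^ suc n * (1 * t ^ (k′ + ℓ))        ≡⟨ cong (λ z → W′ ^ suc n * (1 * z)) (^-distribˡ-+-* t k′ ℓ) ⟩
                    W′ ^ suc n * (1 * (t ^ k′ * t ^ ℓ))    ≡⟨ e₁ (W′ ^ suc n) (t ^ k′) (t ^ ℓ) ⟩
                    t ^ k′ * (t ^ ℓ * W′ ^ suc n)          ≤⟨ enough ⟩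
                    y′ ^ ℓ * (a′ ^ k′ * (W′ ^ suc n * length Z)) ≡⟨ e₂ (y′ ^ ℓ) (a′ ^ k′) (W′ ^ suc n) (length Z) ⟩
                    W′ ^ suc n * (length Z * (a′ ^ k′ * y′ ^ ℓ)) ∎)))
            }
            where
            e₁ : ∀ w p q → w * (1 * (p * q)) ≡ p * (q * w)
            e₁ = solve-∀
            e₂ : ∀ y p w z → y * (p * (w * z)) ≡ w * (z * (p * y))
            e₂ = solve-∀
          potential : t ^ (k + ℓ) * (t ^ ℓ * W′ ^ suc n) * (N * N) ^ n ≤ y′ ^ ℓ * (a′ ^ k * c ^ ℓ) * F ^ suc n
          potential = begin
            t ^ (k + ℓ) * (t ^ ℓ * W′ ^ suc n) * (N * N) ^ n   ≤⟨ *-monoˡ-≤ ((N * N) ^ n) (initial-potential k ℓ N h large ratio h≤) ⟩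
            y′ ^ ℓ * (a′ ^ k * c ^ ℓ) * (N * N) * (N * N) ^ n  ≡⟨ *-assoc (y′ ^ ℓ * (a′ ^ k * c ^ ℓ)) (N * N) _ ⟩
            y′ ^ ℓ * (a′ ^ k * c ^ ℓ) * (N * N) ^ suc n        ≤⟨ *-monoʳ-≤ (y′ ^ ℓ * (a′ ^ k * c ^ ℓ)) (^-mono-≤ (suc n) F≥) ⟩
            y′ ^ ℓ * (a′ ^ k * c ^ ℓ) * F ^ suc n              ∎
          outcome : Book.Outcome G parameters k ℓ Y Y
          outcome = Book.book G parameters N k ℓ Y Y F ≤-refl ≤-refl uY uY F>0
            (∸-exact (t * edges G Y Y) (P * (N * N)) F>0) potential
          finally : Book.Outcome G parameters k ℓ Y Y → Clique R k (_∈ Y) ⊎ Clique B ℓ (_∈ Y)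
          finally (inj₁ K)        = inj₁ (clique-⊆ (λ { (inj₁ p) → p ; (inj₂ p) → p }) K)
          finally (inj₂ (inj₁ K)) = inj₂ K
          finally (inj₂ (inj₂ K)) = inj₂ K
        result : Clique R k (_∈ Y) ⊎ Clique B ℓ (_∈ Y)
        result = let h , h>0 , h≥ , h≤ = size in finally h h>0 h≥ h≤ (outcome h h>0 h≥ h≤)

      sparse : ∀ Y → Unique Y → t ≤ length Y → t * edges G Y Y < suc P * (length Y * length Y) →
        ∃ λ v → v ∈ Y × b * length Y ≤ t * length (nbr B v Y)
      sparse Y uY t≤N few = find-≤ Y (λ _ → b * N) (λ v → t * d v) (≤-trans t>0 t≤N) (begin
        ∑ Y (λ _ → b * N)         ≡⟨ ∑-const Y (b * N) ⟩
        N * (b * N)               ≤⟨ +-cancelʳ-≤ (suc P * (N * N) + N * N) _ _ main ⟩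
        t * ∑ Y d                 ≡⟨ sym (∑-* Y t d) ⟩
        ∑ Y (λ v → t * d v)       ∎)
        where
        open ≤-Reasoning
        N = length Y
        d : V → ℕ
        d v = length (nbr B v Y)
        e = edges G Y Y
        degrees : N * N ≤ N + (e + ∑ Y d)
        degrees = begin
          N * N                                                 ≡⟨ sym (∑-const Y N) ⟩
          ∑ Y (λ _ → N)                                         ≤⟨ ∑-mono Y (λ {v} _ → at v) ⟩
          ∑ Y (λ v → 1 + (length (nbr R v Y) + d v))            ≡⟨ ∑-+ Y _ _ ⟩
          ∑ Y (λ _ → 1) + ∑ Y (λ v → length (nbr R v Y) + d v)  ≡⟨ cong₂ _+_ (sym (length≡∑ G Y)) (∑-+ Y _ _) ⟩
          N + (e + ∑ Y d)                                       ∎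
          where
          at : ∀ v → N ≤ 1 + (length (nbr R v Y) + d v)
          at v = begin
            N                                                           ≡⟨ length≡∑ G Y ⟩
            ∑ Y (λ _ → 1)                                               ≤⟨ split-≤ G v Y uY (λ _ → 1) ⟩
            1 + (∑ (nbr R v Y) (λ _ → 1) + ∑ (nbr B v Y) (λ _ → 1))     ≡⟨ cong suc (cong₂ _+_ (sym (length≡∑ G (nbr R v Y))) (sym (length≡∑ G (nbr B v Y)))) ⟩
            1 + (length (nbr R v Y) + d v)                              ∎
        main : N * (b * N) + (suc P * (N * N) + N * N) ≤ t * ∑ Y d + (suc P * (N * N) + N * N)
        main = begin
          N * (b * N) + (suc P * (N * N) + N * N)        ≡⟨ e₁ N b P ⟩
          (b + 2 + P) * (N * N)                          ≡⟨ cong (_* (N * N)) densities ⟩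
          t * (N * N)                                    ≤⟨ *-monoʳ-≤ t degrees ⟩
          t * (N + (e + ∑ Y d))                          ≡⟨ e₂ t N e (∑ Y d) ⟩
          -- The diagonal costs t N, and t ≤ N bounds this by the single unit N * N reserved for it.
          t * ∑ Y d + (t * e + t * N)                    ≤⟨ +-monoʳ-≤ (t * ∑ Y d) (+-mono-≤ (<⇒≤ few) (*-monoˡ-≤ N t≤N)) ⟩
          t * ∑ Y d + (suc P * (N * N) + N * N)          ∎
          where
          e₁ : ∀ N b P → N * (b * N) + (suc P * (N * N) + N * N) ≡ (b + 2 + P) * (N * N)
          e₁ = solve-∀
          e₂ : ∀ t N e d → t * (N + (e + d)) ≡ t * d + (t * e + t * N)
          e₂ = solve-∀

      -- Below the crossing the old bound is the stronger one. Above it a dense set is handled by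
      -- books, and a sparse one passes to a large blue neighbourhood, which lowers ℓ. In the
      -- constant, C₁ serves the old bound, g the potential, and t ensures |Y| ≥ t.
      improve : ∀ C₁ → RamseyBound G t a₁ b₁ C₁ → RamseyBound G t a b (C₁ + g + t)
      improve C₁ old zero    ℓ       Y uY large = inj₁ clique-∅
      improve C₁ old (suc k) zero    Y uY large = inj₂ clique-∅
      improve C₁ old (suc k) (suc ℓ) Y uY large with suc ℓ * suc den ≤? num * suc k
      ... | yes below = old (suc k) (suc ℓ) Y uY (begin
        C₁ * t ^ (suc k + suc ℓ)                     ≤⟨ *-monoˡ-≤ (t ^ (suc k + suc ℓ)) (≤-trans (m≤m+n C₁ g) (m≤m+n (C₁ + g) t)) ⟩
        (C₁ + g + t) * t ^ (suc k + suc ℓ)           ≤⟨ large ⟩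
        length Y * (a ^ suc k * b ^ suc ℓ)           ≤⟨ *-monoʳ-≤ (length Y) (below-crossing a b a₁ b₁ den num (suc k) (suc ℓ) b>0 b₁≤b old-crossing below) ⟩
        length Y * (a₁ ^ suc k * b₁ ^ suc ℓ)         ∎)
        where open ≤-Reasoning
      ... | no above with suc P * (length Y * length Y) ≤? t * edges G Y Y
      ...   | yes density = dense (suc k) (suc ℓ) Y uY (≤-trans t>0 t≤N) density squared (<⇒≤ (≰⇒> above))
        where
        open ≤-Reasoning
        C = C₁ + g + t
        N = length Y
        T = t ^ (suc k + suc ℓ)
        t≤N : t ≤ N
        t≤N = ≤-trans (m≤n+m t (C₁ + g)) (constant-≤ C (suc k) (suc ℓ) N large)
        squared : g * T * T ≤ N * N * ((a * a) ^ suc k * (b * b) ^ suc ℓ)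
        squared = begin
          g * T * T                          ≡⟨ e₀ g T ⟩
          (g * 1) * (T * T)                  ≤⟨ *-monoˡ-≤ (T * T) (*-mono-≤ (≤-trans (m≤n+m g C₁) (m≤m+n (C₁ + g) t)) (≤-trans t>0 (m≤n+m t (C₁ + g)))) ⟩
          (C * C) * (T * T)                  ≡⟨ e₁ C T ⟩
          (C * T) * (C * T)                  ≤⟨ *-mono-≤ large large ⟩
          N * (a ^ suc k * b ^ suc ℓ) * (N * (a ^ suc k * b ^ suc ℓ)) ≡⟨ e₂ N (a ^ suc k) (b ^ suc ℓ) ⟩
          N * N * (a ^ suc k * a ^ suc k * (b ^ suc ℓ * b ^ suc ℓ))   ≡⟨ cong₂ (λ z w → N * N * (z * w)) (sym (^-distrib-* a a (suc k))) (sym (^-distrib-* b b (suc ℓ))) ⟩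
          N * N * ((a * a) ^ suc k * (b * b) ^ suc ℓ) ∎
          where
          e₀ : ∀ g T → g * T * T ≡ (g * 1) * (T * T)
          e₀ = solve-∀
          e₁ : ∀ C T → (C * C) * (T * T) ≡ (C * T) * (C * T)
          e₁ = solve-∀
          e₂ : ∀ N p q → N * (p * q) * (N * (p * q)) ≡ N * N * (p * p * (q * q))
          e₂ = solve-∀
      ...   | no few = recurse (sparse Y uY t≤N (≰⇒> few))
        where
        open ≤-Reasoning
        C = C₁ + g + t
        N = length Y
        T = t ^ (suc k + suc ℓ)
        t≤N : t ≤ N
        t≤N = ≤-trans (m≤n+m t (C₁ + g)) (constant-≤ C (suc k) (suc ℓ) N large)
        recurse : (∃ λ v → v ∈ Y × b * length Y ≤ t * length (nbr B v Y)) →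
          Clique R (suc k) (_∈ Y) ⊎ Clique B (suc ℓ) (_∈ Y)
        recurse (v , v∈ , high)
          with improve C₁ old (suc k) ℓ (nbr B v Y) (Unique-filterᵇ _ Y uY) (*-cancel-≤ t t>0 (begin
            t * (C * t ^ (suc k + ℓ))                    ≡⟨ e₁ t C (t ^ (suc k + ℓ)) ⟩
            C * t ^ suc (suc k + ℓ)                      ≡⟨ cong (λ z → C * t ^ z) (sym (+-suc (suc k) ℓ)) ⟩
            C * T                                        ≤⟨ large ⟩
            N * (a ^ suc k * (b * b ^ ℓ))                ≡⟨ e₂ N (a ^ suc k) b (b ^ ℓ) ⟩
            b * N * (a ^ suc k * b ^ ℓ)                  ≤⟨ *-monoˡ-≤ _ high ⟩
            t * length (nbr B v Y) * (a ^ suc k * b ^ ℓ) ≡⟨ *-assoc t _ _ ⟩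
            t * (length (nbr B v Y) * (a ^ suc k * b ^ ℓ)) ∎))
          where
          e₁ : ∀ t C p → t * (C * p) ≡ C * (t * p)
          e₁ = solve-∀
          e₂ : ∀ N p b q → N * (p * (b * q)) ≡ b * N * (p * q)
          e₂ = solve-∀
        ... | inj₁ K = inj₁ (clique-⊆ (λ w∈ → proj₁ (∈-filterᵇ (B v) Y w∈)) K)
        ... | inj₂ K = inj₂ (clique-∷ v v∈ (∈-filterᵇ (B v) Y) K)

  -- Ramsey numbers

  Monochromatic : ∀ {N k} → (Fin N → Fin N → Bool) → (Fin k → Fin N) → Bool → Set
  Monochromatic c f b = ∀ i j → i ≢ j → f i ≢ f j × c (f i) (f j) ≡ b

  mono⇒clique : ∀ {N k} (col : Colouring N) (f : Fin k → Fin N) b → Monochromatic (proj₁ col) f b → HasMonoClique col k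
  mono⇒clique col f b mono = f , injective , b , λ i j i≢j → proj₂ (mono i j i≢j)
    where
    injective : Injective _≡_ _≡_ f
    injective {i} {j} eq with i ≟ᶠ j
    ... | yes i≡j = i≡j
    ... | no  i≢j = ⊥-elim (proj₁ (mono i j i≢j) eq)

  clique⇒mono : ∀ {N k} {col : Colouring N} → HasMonoClique col k → ∃ λ f → ∃ λ b → Monochromatic {N} {k} (proj₁ col) f b
  clique⇒mono (f , inj , b , h) = f , b , λ i j i≢j → (λ eq → i≢j (inj eq)) , h i j i≢j

  -- Decoding returns a function or colouring only up to pointwise equality; this transfer makes the
  -- exhaustive searches complete.
  mono-cong : ∀ {N k} {c c′ : Fin N → Fin N → Bool} {f f′ : Fin k → Fin N} {b} →
    (∀ u v → c u v ≡ c′ u v) → (∀ i → f i ≡ f′ i) → Monochromatic c f b → Monochromatic c′ f′ b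
  mono-cong {c = c} c≗ f≗ mono i j i≢j =
    (λ eq → proj₁ (mono i j i≢j) (trans (f≗ i) (trans eq (sym (f≗ j)))))
    , trans (sym (trans (cong₂ c (f≗ i) (f≗ j)) (c≗ _ _))) (proj₂ (mono i j i≢j))

  monochromatic? : ∀ {N k} (c : Fin N → Fin N → Bool) (f : Fin k → Fin N) b → Dec (Monochromatic c f b)
  monochromatic? c f b = all? λ i → all? λ j → ¬? (i ≟ᶠ j) →-dec (¬? (f i ≟ᶠ f j) ×-dec (c (f i) (f j) ≟ᵇ b))

  hasMonoClique? : ∀ {N} (col : Colouring N) k → Dec (HasMonoClique col k)
  hasMonoClique? {N} col@(c , _) k = map′ to from
    (any? λ i → monochromatic? c (decode i) true ⊎-dec monochromatic? c (decode i) false)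
    where
    decode : Fin (N ^ k) → Fin k → Fin N
    decode = finToFun
    Coded : Fin (N ^ k) → Set
    Coded i = Monochromatic c (decode i) true ⊎ Monochromatic c (decode i) false
    to : ∃ Coded → HasMonoClique col k
    to (i , inj₁ m) = mono⇒clique col (decode i) true m
    to (i , inj₂ m) = mono⇒clique col (decode i) false m
    recode : ∀ {f b} → Monochromatic c f b → Monochromatic c (decode (funToFin f)) b
    recode {f} = mono-cong {c = c} {c′ = c} (λ _ _ → refl) (λ i → sym (finToFun-funToFin f i))
    from : HasMonoClique col k → ∃ Coded
    from K with clique⇒mono {col = col} K
    ... | f , true  , m = funToFin f , inj₁ (recode m)
    ... | f , false , m = funToFin f , inj₂ (recode m)

  ramseyProperty? : ∀ k N → Dec (RamseyProperty k N)
  ramseyProperty? k N = map′ to (λ h i → h (decode i)) (all? λ i → hasMonoClique? (decode i) k)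
    where
    bit : Fin 2 → Bool
    bit zero       = false
    bit (suc zero) = true
    unbit : Bool → Fin 2
    unbit false = zero
    unbit true  = suc zero
    bit-unbit : ∀ b → bit (unbit b) ≡ b
    bit-unbit false = refl
    bit-unbit true  = refl
    raw : Fin ((2 ^ N) ^ N) → Fin N → Fin N → Bool
    raw i u v = bit (finToFun {2} {N} (finToFun {2 ^ N} {N} i u) v)
    code : (Fin N → Fin N → Bool) → Fin ((2 ^ N) ^ N)
    code c = funToFin (λ u → funToFin (λ v → unbit (c u v)))
    raw-code : ∀ c u v → raw (code c) u v ≡ c u v
    raw-code c u v = trans (cong (λ z → bit (finToFun {2} {N} z v)) (finToFun-funToFin (λ u → funToFin (λ v → unbit (c u v))) u))
      (trans (cong bit (finToFun-funToFin (λ v → unbit (c u v)) v)) (bit-unbit (c u v)))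
    -- Codes range over all Boolean matrices. Conjunction with the transpose makes each one
    -- symmetric and fixes those that already are, so every colouring is reached.
    decode : Fin ((2 ^ N) ^ N) → Colouring N
    decode i = (λ u v → raw i u v ∧ raw i v u) , λ u v → ∧-comm (raw i u v) (raw i v u)
    to : (∀ i → HasMonoClique (decode i) k) → RamseyProperty k N
    to h col@(c , c-sym) with clique⇒mono {col = decode (code c)} (h (code c))
    ... | f , b , m = mono⇒clique col f b (mono-cong {f = f}
      (λ u v → trans (cong₂ _∧_ (raw-code c u v) (trans (raw-code c v u) (c-sym v u))) (∧-idem (c u v))) (λ _ → refl) m)

  least : {P : ℕ → Set} → (∀ n → Dec (P n)) → ∀ n → P n → ∃ λ m → P m × m ≤ n × (∀ j → P j → m ≤ j)
  least {P} P? n pn with search n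
    where
    search : ∀ n → (∃ λ m → P m × m ≤ n × (∀ j → P j → m ≤ j)) ⊎ (∀ j → j ≤ n → ¬ P j)
    search zero with P? 0
    ... | yes p = inj₁ (0 , p , z≤n , λ _ _ → z≤n)
    ... | no ¬p = inj₂ λ { zero _ → ¬p }
    search (suc n) with search n
    ... | inj₁ (m , p , m≤ , min) = inj₁ (m , p , m≤n⇒m≤1+n m≤ , min)
    ... | inj₂ none with P? (suc n)
    ...   | yes p = inj₁ (suc n , p , ≤-refl , λ j pj → ≰⇒> (λ j≤n → none j j≤n pj))
    ...   | no ¬p = inj₂ λ j j≤ pj → decide j j≤ pj
      where
      decide : ∀ j → j ≤ suc n → ¬ P j
      decide j j≤ pj with j ≤? n
      ... | yes j≤n = none j j≤n pj
      ... | no j≰n  = ¬p (subst P (≤-antisym j≤ (≰⇒> j≰n)) pj)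
  ... | inj₁ r    = r
  ... | inj₂ none = ⊥-elim (none n ≤-refl pn)

  colourGraph : ∀ {N} → Colouring N → Graph (Fin N)
  colourGraph {N} (c , c-sym) = record
    { R = λ u v → not (does (u ≟ᶠ v)) ∧ c u v
    ; B = λ u v → not (does (u ≟ᶠ v)) ∧ not (c u v)
    ; R-irrefl = λ v → irrefl v (c v v)
    ; B-irrefl = λ v → irrefl v (not (c v v))
    ; B-sym = B-sym
    ; cover = cover }
    where
    irrefl : ∀ v b → not (does (v ≟ᶠ v)) ∧ b ≡ false
    irrefl v b with v ≟ᶠ v
    ... | yes _  = refl
    ... | no v≢v = ⊥-elim (v≢v refl)
    B-sym : ∀ u v → not (does (u ≟ᶠ v)) ∧ not (c u v) ≡ not (does (v ≟ᶠ u)) ∧ not (c v u)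
    B-sym u v with u ≟ᶠ v | v ≟ᶠ u
    ... | yes _    | yes _    = refl
    ... | yes refl | no v≢u   = ⊥-elim (v≢u refl)
    ... | no u≢v   | yes refl = ⊥-elim (u≢v refl)
    ... | no _     | no _     = cong not (c-sym u v)
    cover : ∀ u v → u ≡ v ⊎
      (not (does (u ≟ᶠ v)) ∧ c u v ≡ true × not (does (u ≟ᶠ v)) ∧ not (c u v) ≡ false) ⊎
      (not (does (u ≟ᶠ v)) ∧ c u v ≡ false × not (does (u ≟ᶠ v)) ∧ not (c u v) ≡ true)
    cover u v with u ≟ᶠ v | c u v
    ... | yes p | _     = inj₁ p
    ... | no _  | true  = inj₂ (inj₁ (refl , refl))
    ... | no _  | false = inj₂ (inj₂ (refl , refl))

  lookup-pairs : ∀ {A : Set} {r : A → A → Set} → (∀ {x y} → r x y → r y x) → ∀ xs → AllPairs r xs →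
    ∀ i j → i ≢ j → r (lookup xs i) (lookup xs j)
  lookup-pairs s (x ∷ xs) (p ∷ ps) zero    zero    i≢j = ⊥-elim (i≢j refl)
  lookup-pairs s (x ∷ xs) (p ∷ ps) zero    (suc j) i≢j = All.lookup p (∈-lookup {xs = xs} j)
  lookup-pairs s (x ∷ xs) (p ∷ ps) (suc i) zero    i≢j = s (All.lookup p (∈-lookup {xs = xs} i))
  lookup-pairs s (x ∷ xs) (p ∷ ps) (suc i) (suc j) i≢j = lookup-pairs s xs ps i j (λ eq → i≢j (cong suc eq))

  bound⇒property : ∀ {t a b C} → (∀ {V} (G : Graph V) → RamseyBound G t a b C) →
    ∀ k N → C * t ^ (k + k) ≤ N * (a ^ k * b ^ k) → RamseyProperty k N
  bound⇒property {t} {a} {b} {C} bound k N large col@(c , c-sym)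
    with bound (colourGraph col) k k (allFin N) (allFin⁺ N)
           (subst (λ z → C * t ^ (k + k) ≤ z * (a ^ k * b ^ k)) (sym (length-tabulate {n = N} (λ i → i))) large)
  ... | inj₁ (vs , refl , prs , _) = mono⇒clique col (lookup vs) true
          (lookup-pairs (λ { (u≢v , e) → (λ eq → u≢v (sym eq)) , trans (c-sym _ _) e }) vs (AllPairs.map (λ {u} {v} → red u v) prs))
    where
    red : ∀ u v → not (does (u ≟ᶠ v)) ∧ c u v ≡ true → u ≢ v × c u v ≡ true
    red u v e with u ≟ᶠ v
    ... | no u≢v = u≢v , e
  ... | inj₂ (vs , refl , prs , _) = mono⇒clique col (lookup vs) false
          (lookup-pairs (λ { (u≢v , e) → (λ eq → u≢v (sym eq)) , trans (c-sym _ _) e }) vs (AllPairs.map (λ {u} {v} → blue u v) prs))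
    where
    blue : ∀ u v → not (does (u ≟ᶠ v)) ∧ not (c u v) ≡ true → u ≢ v × c u v ≡ false
    blue u v e with u ≟ᶠ v | c u v
    ... | no u≢v | false = u≢v , refl

  n≤2^n : ∀ n → n ≤ 2 ^ n
  n≤2^n zero    = z≤n
  n≤2^n (suc n) = +-mono-≤ (^-pos {2} n (s≤s z≤n)) (≤-trans (n≤2^n n) (≤-reflexive (sym (+-identityʳ _))))

  -- `rate` says (t/a)(t/b) ≤ 2^(p/(q + 1)), the growth per unit of k on the diagonal. Rounding the
  -- bound up to an integer at most doubles C, and 2 C ≤ 2^(2 C) moves the constant into the
  -- exponent. Decidability provides the least N.
  ramsey-number-≤ : ∀ {t a b C} p q → 0 < t → 0 < a → 0 < b → a ≤ t → b ≤ t → 0 < C →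
    (t * t) ^ suc q ≤ 2 ^ p * (a * b) ^ suc q → (∀ {V} (G : Graph V) → RamseyBound G t a b C) →
    ∀ k → ∃ λ N → IsRamseyNumber k N × N ^ suc q ≤ 2 ^ (p * k + suc q * (2 * C))
  ramsey-number-≤ {t} {a} {b} {C} p q′ t>0 a>0 b>0 a≤t b≤t C>0 rate bound k =
    N , (property , minimal) , *-cancel-≤ (d ^ q) (^-pos q d>0) (begin
      d ^ q * N ^ q                             ≡⟨ trans (*-comm _ (N ^ q)) (sym (^-distrib-* N d q)) ⟩
      (N * d) ^ q                               ≤⟨ ^-mono-≤ q (≤-trans (*-monoˡ-≤ d N≤h) h≤) ⟩
      (2 * (C * t ^ (k + k))) ^ q               ≡⟨ cong (_^ q) (sym (*-assoc 2 C _)) ⟩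
      (2 * C * t ^ (k + k)) ^ q                 ≡⟨ cong (λ z → (2 * C * z) ^ q) square ⟩
      (2 * C * (t * t) ^ k) ^ q                 ≡⟨ trans (^-distrib-* (2 * C) _ q) (cong ((2 * C) ^ q *_) (^-comm (t * t) k q)) ⟩
      (2 * C) ^ q * ((t * t) ^ q) ^ k           ≤⟨ *-mono-≤ (^-mono-≤ q (n≤2^n (2 * C))) (^-mono-≤ k rate) ⟩
      (2 ^ (2 * C)) ^ q * (2 ^ p * (a * b) ^ q) ^ k
        ≡⟨ cong₂ _*_ (trans (^-*-assoc 2 (2 * C) q) (cong (2 ^_) (*-comm (2 * C) q)))
             (trans (^-distrib-* (2 ^ p) ((a * b) ^ q) k)
               (cong₂ _*_ (^-*-assoc 2 p k) (trans (^-comm (a * b) q k) (cong (_^ q) (^-distrib-* a b k))))) ⟩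
      2 ^ (q * (2 * C)) * (2 ^ (p * k) * d ^ q) ≡⟨ e₁ (2 ^ (q * (2 * C))) (2 ^ (p * k)) (d ^ q) ⟩
      d ^ q * (2 ^ (p * k) * 2 ^ (q * (2 * C))) ≡⟨ cong (d ^ q *_) (sym (^-distribˡ-+-* 2 (p * k) _)) ⟩
      d ^ q * 2 ^ (p * k + q * (2 * C))         ∎)
    where
    open ≤-Reasoning
    q = suc q′
    d = a ^ k * b ^ k
    d>0 : 0 < d
    d>0 = *-mono-≤ (^-pos k a>0) (^-pos k b>0)
    e₁ : ∀ x y z → x * (y * z) ≡ z * (y * x)
    e₁ = solve-∀
    square : t ^ (k + k) ≡ (t * t) ^ k
    square = trans (^-distribˡ-+-* t k k) (sym (^-distrib-* t t k))
    d≤ : d ≤ C * t ^ (k + k)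
    d≤ = begin
      a ^ k * b ^ k          ≤⟨ *-mono-≤ (^-mono-≤ k a≤t) (^-mono-≤ k b≤t) ⟩
      t ^ k * t ^ k          ≡⟨ sym (^-distribˡ-+-* t k k) ⟩
      t ^ (k + k)            ≡⟨ sym (*-identityˡ _) ⟩
      1 * t ^ (k + k)        ≤⟨ *-monoˡ-≤ _ C>0 ⟩
      C * t ^ (k + k)        ∎
    size = ceiling (C * t ^ (k + k)) d d>0 d≤
    h = proj₁ size
    h≤ : h * d ≤ 2 * (C * t ^ (k + k))
    h≤ = proj₂ (proj₂ (proj₂ size))
    minimum = least (ramseyProperty? k) h (bound⇒property {t} {a} {b} {C} bound k h (proj₁ (proj₂ (proj₂ size))))
    N = proj₁ minimum
    property = proj₁ (proj₂ minimum)
    N≤h : N ≤ h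
    N≤h = proj₁ (proj₂ (proj₂ minimum))
    minimal = proj₂ (proj₂ (proj₂ minimum))

open import Data.Nat as ℕ using (ℕ; zero; suc; _≥_; z≤n; s≤s)
import Data.Nat.Properties as ℕₚ
open import Data.Nat.Properties using (≤ᵇ⇒≤; ≤-trans; m≤n+m)
open import Data.Unit using (tt)
open import Data.Integer as ℤ using (+_; -[1+_]; +[1+_])
import Data.Integer.Properties as ℤₚ
open import Data.Integer.GCD using (gcd)
open import Data.Rational using (ℚ; mkℚ; _/_; _+_; _-_; _*_; _<_; ∣_∣; 0ℚ; 1ℚ; *<*; ↥_; ↧_; toℚᵘ)
import Data.Rational.Properties as ℚₚ
open import Data.Rational.Unnormalised as ℚᵘ using (mkℚᵘ; *≡*)
import Data.Rational.Unnormalised.Properties as ℚᵘₚ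
open import Data.Product using (Σ; ∃; _×_; _,_; proj₁; proj₂; ∃-syntax)
open import Data.Empty using (⊥-elim)
open import Relation.Binary.PropositionalEquality using (_≡_; refl; sym; trans; cong; cong₂; subst; subst₂)
open RamseyBounds

-- Numerical parameters and the diagonal bound

step₁ : Step 1000 770 230 676 342
step₁ = record
  -- In all four steps c = γ - 1, and the spine has q + 1 = 1000 vertices so that (γ/c)^(q + 1)
  -- outweighs ((n + 1)/n)^(n + 1), which is about e. The fine denominator E leaves room for the
  -- loss 2/E, and the large s makes the exceptional set cheap.
  { P = 656 ; β′ = 780 ; γ = 219 ; A = 998831 ; Δ = 5303 ; E = 1000000 ; n = 99 ; a′ = 455 ; y′ = 545
  ; c = 218 ; q = 999 ; s = 1000000 ; num = 6 ; den = 19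
  ; P>0 = s≤s z≤n ; γ>0 = s≤s z≤n ; E>0 = s≤s z≤n ; n>0 = s≤s z≤n ; s>0 = s≤s z≤n ; b>0 = s≤s z≤n
  ; a′>0 = s≤s z≤n ; y′>0 = s≤s z≤n ; c>0 = s≤s z≤n
  ; a≤t = ≤ᵇ⇒≤ _ _ tt ; c≤t = ≤ᵇ⇒≤ _ _ tt ; b₁≤b = ≤ᵇ⇒≤ _ _ tt
  ; densities = refl ; es-line = refl ; β-sum = refl
  ; red-cost = ≤ᵇ⇒≤ _ _ tt ; blue-cost = ≤ᵇ⇒≤ _ _ tt ; book-cost = ≤ᵇ⇒≤ _ _ tt ; slack = ≤ᵇ⇒≤ _ _ tt
  ; old-crossing = ≤ᵇ⇒≤ _ _ tt ; book-slope = ≤ᵇ⇒≤ _ _ tt ; book-crossing = ≤ᵇ⇒≤ _ _ tt }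

step₂ : Step 1000 676 342 627 391
step₂ = record
  { P = 607 ; β′ = 695 ; γ = 304 ; A = 997829 ; Δ = 7110 ; E = 1000000 ; n = 99 ; a′ = 339 ; y′ = 661
  ; c = 303 ; q = 999 ; s = 1000000 ; num = 11 ; den = 19
  ; P>0 = s≤s z≤n ; γ>0 = s≤s z≤n ; E>0 = s≤s z≤n ; n>0 = s≤s z≤n ; s>0 = s≤s z≤n ; b>0 = s≤s z≤n
  ; a′>0 = s≤s z≤n ; y′>0 = s≤s z≤n ; c>0 = s≤s z≤n
  ; a≤t = ≤ᵇ⇒≤ _ _ tt ; c≤t = ≤ᵇ⇒≤ _ _ tt ; b₁≤b = ≤ᵇ⇒≤ _ _ tt
  ; densities = refl ; es-line = refl ; β-sum = refl
  ; red-cost = ≤ᵇ⇒≤ _ _ tt ; blue-cost = ≤ᵇ⇒≤ _ _ tt ; book-cost = ≤ᵇ⇒≤ _ _ tt ; slack = ≤ᵇ⇒≤ _ _ tt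
  ; old-crossing = ≤ᵇ⇒≤ _ _ tt ; book-slope = ≤ᵇ⇒≤ _ _ tt ; book-crossing = ≤ᵇ⇒≤ _ _ tt }

step₃ : Step 1000 627 391 592 424
step₃ = record
  { P = 574 ; β′ = 660 ; γ = 339 ; A = 997159 ; Δ = 8349 ; E = 1000000 ; n = 99 ; a′ = 285 ; y′ = 715
  ; c = 338 ; q = 999 ; s = 1000000 ; num = 14 ; den = 19
  ; P>0 = s≤s z≤n ; γ>0 = s≤s z≤n ; E>0 = s≤s z≤n ; n>0 = s≤s z≤n ; s>0 = s≤s z≤n ; b>0 = s≤s z≤n
  ; a′>0 = s≤s z≤n ; y′>0 = s≤s z≤n ; c>0 = s≤s z≤n
  ; a≤t = ≤ᵇ⇒≤ _ _ tt ; c≤t = ≤ᵇ⇒≤ _ _ tt ; b₁≤b = ≤ᵇ⇒≤ _ _ tt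
  ; densities = refl ; es-line = refl ; β-sum = refl
  ; red-cost = ≤ᵇ⇒≤ _ _ tt ; blue-cost = ≤ᵇ⇒≤ _ _ tt ; book-cost = ≤ᵇ⇒≤ _ _ tt ; slack = ≤ᵇ⇒≤ _ _ tt
  ; old-crossing = ≤ᵇ⇒≤ _ _ tt ; book-slope = ≤ᵇ⇒≤ _ _ tt ; book-crossing = ≤ᵇ⇒≤ _ _ tt }

step₄ : Step 1000 592 424 559 453
step₄ = record
  { P = 545 ; β′ = 620 ; γ = 379 ; A = 996297 ; Δ = 9739 ; E = 1000000 ; n = 99 ; a′ = 233 ; y′ = 767
  ; c = 378 ; q = 999 ; s = 1000000 ; num = 17 ; den = 19
  ; P>0 = s≤s z≤n ; γ>0 = s≤s z≤n ; E>0 = s≤s z≤n ; n>0 = s≤s z≤n ; s>0 = s≤s z≤n ; b>0 = s≤s z≤n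
  ; a′>0 = s≤s z≤n ; y′>0 = s≤s z≤n ; c>0 = s≤s z≤n
  ; a≤t = ≤ᵇ⇒≤ _ _ tt ; c≤t = ≤ᵇ⇒≤ _ _ tt ; b₁≤b = ≤ᵇ⇒≤ _ _ tt
  ; densities = refl ; es-line = refl ; β-sum = refl
  ; red-cost = ≤ᵇ⇒≤ _ _ tt ; blue-cost = ≤ᵇ⇒≤ _ _ tt ; book-cost = ≤ᵇ⇒≤ _ _ tt ; slack = ≤ᵇ⇒≤ _ _ tt
  ; old-crossing = ≤ᵇ⇒≤ _ _ tt ; book-slope = ≤ᵇ⇒≤ _ _ tt ; book-crossing = ≤ᵇ⇒≤ _ _ tt }

AllBounds : (t a b : ℕ) → Set₁
AllBounds t a b = Σ ℕ λ C → 0 ℕ.< C × (∀ {V} (G : Graph V) → RamseyBound G t a b C)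

improve-all : ∀ {t a₁ b₁ a b} → Step t a₁ b₁ a b → AllBounds t a₁ b₁ → AllBounds t a b
improve-all {t} 𝒮 (C₁ , C₁>0 , old) =
  C₁ ℕ.+ Improve.g 𝒮 ℕ.+ t , ≤-trans (Improve.t>0 𝒮) (m≤n+m t _) , λ G → Improve.improve 𝒮 G C₁ (old G)

-- The constant contains four values of g, each with hundreds of millions of digits, and must not be
-- evaluated.
abstract
  final-bound : AllBounds 1000 559 453
  final-bound = improve-all step₄ (improve-all step₃ (improve-all step₂ (improve-all step₁
    (1 , s≤s z≤n , λ G → erdős-szekeres G 770 230 (s≤s z≤n) (s≤s z≤n)))))

constant : ℕ
constant = 2 ℕ.* proj₁ final-bound

ramsey-numbers : ∀ k → ∃ λ N → IsRamseyNumber k N × N ℕ.^ 200 ℕ.≤ 2 ℕ.^ (397 ℕ.* k ℕ.+ 200 ℕ.* constant)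
-- 397/200 = 2 - 3/200; the rate to be checked is 1/(0.559 · 0.453) ≤ 2^(397/200).
ramsey-numbers = ramsey-number-≤ {1000} {559} {453} {proj₁ final-bound} 397 199
  (s≤s z≤n) (s≤s z≤n) (s≤s z≤n) (≤ᵇ⇒≤ _ _ tt) (≤ᵇ⇒≤ _ _ tt) (proj₁ (proj₂ final-bound)) (≤ᵇ⇒≤ _ _ tt)
  (proj₂ (proj₂ final-bound))

-- Rational exponents and the error term

≤2^-/ : ∀ N a b .{{_ : ℕ.NonZero b}} → N ℕ.^ b ℕ.≤ 2 ℕ.^ a → N ≤2^ (+ a / b)
≤2^-/ N a b h = reduce (+ a / b) (gcd (+ a) (+ b)) refl (ℚₚ.↥-/ (+ a) b) (ℚₚ.↧-/ (+ a) b)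
  where
  reduce : ∀ x g → g ≡ gcd (+ a) (+ b) → ↥ x ℤ.* gcd (+ a) (+ b) ≡ + a → ↧ x ℤ.* gcd (+ a) (+ b) ≡ + b → N ≤2^ x
  reduce x (+ zero) eq num den = ⊥-elim (ℕ.≢-nonZero⁻¹ b (ℤₚ.+-injective (trans (sym den) (trans (cong (↧ x ℤ.*_) (sym eq)) (ℤₚ.*-zeroʳ (↧ x))))))
  -- The exponent is stored in lowest terms p/(d + 1), with a = p (g + 1) and b = (d + 1)(g + 1).
  -- The hypothesis is thus the (g + 1)-th power of the goal.
  reduce (mkℚ (+ p) d _) +[1+ g ] eq num den = ^-cancel-≤ g (begin
    (N ℕ.^ suc d) ℕ.^ suc g      ≡⟨ ℕₚ.^-*-assoc N (suc d) (suc g) ⟩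
    N ℕ.^ (suc d ℕ.* suc g)      ≡⟨ cong (N ℕ.^_) (ℤₚ.+-injective (trans (ℤₚ.pos-* (suc d) (suc g)) (trans (cong (+ suc d ℤ.*_) eq) den))) ⟩
    N ℕ.^ b                      ≤⟨ h ⟩
    2 ℕ.^ a                      ≡⟨ cong (2 ℕ.^_) (sym (ℤₚ.+-injective (trans (ℤₚ.pos-* p (suc g)) (trans (cong (+ p ℤ.*_) eq) num)))) ⟩
    2 ℕ.^ (p ℕ.* suc g)          ≡⟨ sym (ℕₚ.^-*-assoc 2 p (suc g)) ⟩
    (2 ℕ.^ p) ℕ.^ suc g          ∎)
    where open ℕₚ.≤-Reasoning
  reduce (mkℚ -[1+ p ] d _) +[1+ g ] eq num den with trans (cong (-[1+ p ] ℤ.*_) eq) num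
  ... | ()
  reduce x -[1+ g ] () num den

-- Unnormalised fractions take no gcd, so in this form the equation between exponents becomes an
-- identity of integers.
toℚᵘ-linear : ∀ r k c → toℚᵘ (r * (+ k / 1) + + c / 1) ℚᵘ.≃ toℚᵘ r ℚᵘ.* mkℚᵘ (+ k) 0 ℚᵘ.+ mkℚᵘ (+ c) 0
toℚᵘ-linear r k c = ℚᵘₚ.≃-trans (ℚₚ.toℚᵘ-homo-+ (r * (+ k / 1)) (+ c / 1)) (ℚᵘₚ.+-cong
  {toℚᵘ (r * (+ k / 1))} {toℚᵘ r ℚᵘ.* mkℚᵘ (+ k) 0} {toℚᵘ (+ c / 1)} {mkℚᵘ (+ c) 0}
  (ℚᵘₚ.≃-trans (ℚₚ.toℚᵘ-homo-* r (+ k / 1))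
    (ℚᵘₚ.*-congˡ {toℚᵘ r} {toℚᵘ (+ k / 1)} {mkℚᵘ (+ k) 0} (ℚₚ.toℚᵘ-fromℚᵘ (mkℚᵘ (+ k) 0))))
  (ℚₚ.toℚᵘ-fromℚᵘ (mkℚᵘ (+ c) 0)))

exponent : ∀ k c → ((1ℚ + 1ℚ) - + 3 / 200) * (+ k / 1) + + c / 1 ≡ + (397 ℕ.* k ℕ.+ 200 ℕ.* c) / 200
exponent k c = ℚₚ.toℚᵘ-injective (ℚᵘₚ.≃-trans (toℚᵘ-linear ((1ℚ + 1ℚ) - + 3 / 200) k c)
  (ℚᵘₚ.≃-trans (*≡* numerators) (ℚᵘₚ.≃-sym (ℚₚ.toℚᵘ-fromℚᵘ (mkℚᵘ (+ (397 ℕ.* k ℕ.+ 200 ℕ.* c)) 199)))))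
  where
  numerators : (+ 397 ℤ.* + k ℤ.* + 1 ℤ.+ + c ℤ.* + 200) ℤ.* + 200 ≡ + (397 ℕ.* k ℕ.+ 200 ℕ.* c) ℤ.* + 200
  numerators = cong (ℤ._* + 200) (trans
    (cong₂ ℤ._+_ (trans (ℤₚ.*-identityʳ _) (sym (ℤₚ.pos-* 397 k))) (trans (ℤₚ.*-comm (+ c) (+ 200)) (sym (ℤₚ.pos-* 200 c))))
    (sym (ℤₚ.pos-+ (397 ℕ.* k) (200 ℕ.* c))))

constant-sublinear : ∀ c (ε : ℚ) → 0ℚ < ε → ∃[ K ] (∀ k → k ≥ K → ∣ + c / 1 ∣ < ε * (+ k / 1))
constant-sublinear c (mkℚ (+ zero)  d _) (*<* (ℤ.+<+ ()))
constant-sublinear c (mkℚ -[1+ e ] d _) (*<* ())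
-- With ε = (e + 1)/(d + 1) the threshold (c + 1)(d + 1) works, since c (d + 1) < (c + 1)(d + 1) ≤ k
-- ≤ (e + 1) k.
constant-sublinear c ε@(mkℚ +[1+ e ] d _) ε>0 = suc c ℕ.* suc d , λ k k≥ →
  subst (_< ε * (+ k / 1)) (sym (ℚₚ.0≤p⇒∣p∣≡p nonneg)) (ℚₚ.toℚᵘ-cancel-< (below k k≥))
  where
  nonneg : 0ℚ Data.Rational.≤ + c / 1
  nonneg = ℚₚ.toℚᵘ-cancel-≤ (ℚᵘₚ.≤-respʳ-≃ (ℚᵘₚ.≃-sym (ℚₚ.toℚᵘ-fromℚᵘ (mkℚᵘ (+ c) 0)))
    (ℚᵘ.*≤* (subst₂ ℤ._≤_ refl (sym (ℤₚ.*-identityʳ (+ c))) (ℤ.+≤+ z≤n))))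
  below : ∀ k → k ≥ suc c ℕ.* suc d → toℚᵘ (+ c / 1) ℚᵘ.< toℚᵘ (ε * (+ k / 1))
  below k k≥ = ℚᵘₚ.<-respˡ-≃ (ℚᵘₚ.≃-sym (ℚₚ.toℚᵘ-fromℚᵘ (mkℚᵘ (+ c) 0)))
    (ℚᵘₚ.<-respʳ-≃ (ℚᵘₚ.≃-sym (ℚᵘₚ.≃-trans (ℚₚ.toℚᵘ-homo-* ε (+ k / 1)) (ℚᵘₚ.*-congˡ {toℚᵘ ε} (ℚₚ.toℚᵘ-fromℚᵘ (mkℚᵘ (+ k) 0)))))
      (ℚᵘ.*<* (subst₂ ℤ._<_ (ℤₚ.pos-* c (suc d ℕ.* 1)) (trans (ℤₚ.pos-* (suc e) k) (sym (ℤₚ.*-identityʳ (+ suc e ℤ.* + k))))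
        (ℤ.+<+ (begin-strict
          c ℕ.* (suc d ℕ.* 1)     ≡⟨ cong (c ℕ.*_) (ℕₚ.*-identityʳ (suc d)) ⟩
          c ℕ.* suc d             <⟨ ℕₚ.m<n+m (c ℕ.* suc d) (s≤s z≤n) ⟩
          suc c ℕ.* suc d         ≤⟨ k≥ ⟩
          k                       ≤⟨ ℕₚ.m≤m+n k (e ℕ.* k) ⟩
          suc e ℕ.* k             ∎)))))
    where open ℕₚ.≤-Reasoning

theorem4p5 : Σ (ℕ → ℚ) λ g →
    ((ε : ℚ) → 0ℚ < ε → ∃[ K ] (∀ k → k ≥ K → ∣ g k ∣ < ε * (+ k / 1)))
    × (∀ k → k ≥ 2 → ∃[ N ] (IsRamseyNumber k N
    × N ≤2^ (((1ℚ + 1ℚ) - + 3 / 200) * (+ k / 1) + g k)))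
-- A constant error term is enough, because the final linear bound has a factor C independent of k.
theorem4p5 = (λ _ → + constant / 1) , constant-sublinear constant , λ k _ →
  let N , isRamsey , N≤ = ramsey-numbers k
  in N , isRamsey , subst (N ≤2^_) (sym (exponent k constant)) (≤2^-/ N (397 ℕ.* k ℕ.+ 200 ℕ.* constant) 200 N≤)
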